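{- There is a polynomial-time algorithm which, given a unary NFA $\mathscr{A}$, outputs an equivalent unary NFA in Chrobak normal form, with at most quadratic blow-up (i.e. if $\mathscr{A}$ has $n$ states, then the output has $O(n^2)$ states).
   Context: A unary NFA is a quadruple $\mathscr{A}=(Q,q_0,\delta,F)$ where $Q$ is a finite set of states, $q_0\in Q$ is the initial state, $\delta\subseteq Q\times Q$ is the transition relation, and $F\subseteq Q$ is the set of final states; as algorithm input or output it is given explicitly (list of states, transitions, initial state, final states). For $q\in Q$ let $succ(q)=\{q' : (q,q')\in\delta\}$. Since the alphabet is a singleton, the language $L(\mathscr{A})$ is identified with the set of all $x\in\mathbb{N}=\{0,1,2,\ldots\}$ such that there is a path (vertices may repeat) with exactly $x$ transitions from $q_0$ to some state of $F$. Two unary NFAs are equivalent if they have the same language. A unary NFA $(Q,q_0,\delta,F)$ is in Chrobak normal form if $Q$ is the union of $\{q_0,\ldots,q_m\}$ and sets $C_1,\ldots,C_k$, all these sets being pairwise disjoint, such that: (i) for each $1\le i\le k$, $C_i=\{p_{i,0},p_{i,1},\ldots,p_{i,j_i-1}\}$ for some integer $j_i>0$; (ii) for each $0\le i\le m-1$, $succ(q_i)=\{q_{i+1}\}$; (iii) $succ(q_m)=\{p_{1,0},p_{2,0},\ldots,p_{k,0}\}$; (iv) for every $1\le i\le k$ and $0\le h\le j_i-1$, $succ(p_{i,h})=\{p_{i,(h+1 \bmod j_i)}\}$. There is no restriction on the set of final states $F\subseteq Q$. -}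

module Defs where

open import Data.Bool using (if_then_else_)
open import Data.Fin using (Fin; toℕ; fromℕ; inject₁) renaming (zero to fzero; suc to fsuc)
open import Data.List using (List; []; _∷_; map; allFin)
open import Data.List.Membership.Propositional using (_∈_)
open import Data.Nat using (ℕ; zero; suc; _+_; _*_; _^_; _≤_; _≡ᵇ_; NonZero)
open import Data.Nat.DivMod using (_mod_)
open import Data.Product using (∃-syntax; _×_; _,_)
open import Data.Sum using (_⊎_)
open import Function.Bundles using (_⇔_)
open import Function.Definitions using (Injective)
open import Relation.Binary.PropositionalEquality using (_≡_; _≢_)

-- The states are named 0, …, size − 1.  Transitions and final states are
-- finite sets given by listing their elements; only membership matters
-- for the language.
record UnaryNFA : Set where
  field
    size        : ℕ
    initial     : Fin size
    transitions : List (Fin size × Fin size)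
    final       : List (Fin size)

  State : Set
  State = Fin size

  _∈succ_ : State → State → Set
  q′ ∈succ q = (q , q′) ∈ transitions

  data Path : ℕ → State → State → Set where
    stay : ∀ {q} → Path 0 q q
    step : ∀ {x q q′ q″} → q′ ∈succ q → Path x q′ q″ → Path (suc x) q q″

  Accepts : ℕ → Set
  Accepts x = ∃[ q ] (q ∈ final × Path x initial q)

open UnaryNFA using (Accepts)

Equivalent : UnaryNFA → UnaryNFA → Set
Equivalent A B = ∀ x → Accepts A x ⇔ Accepts B x

-- q-injective and p-injective say that the elements of {q₀,…,q_m} and of
-- each {p_{i,0},…,p_{i,jᵢ-1}} are listed without repetition.
record ChrobakNormalForm (A : UnaryNFA) : Set where
  open UnaryNFA A using (State; initial; _∈succ_)
  field
    m k : ℕ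
    j   : Fin k → ℕ
    ⦃ j-nonZero ⦄ : ∀ {i} → NonZero (j i)
    q   : Fin (suc m) → State
    p   : (i : Fin k) → Fin (j i) → State

    q-initial : q fzero ≡ initial

    cover       : ∀ s → (∃[ i ] s ≡ q i) ⊎ (∃[ i ] ∃[ h ] s ≡ p i h)
    q-injective : Injective _≡_ _≡_ q
    p-injective : ∀ i → Injective _≡_ _≡_ (p i)
    q-p-disjoint : ∀ l i h → q l ≢ p i h
    p-p-disjoint : ∀ {i i′} → i ≢ i′ → ∀ h h′ → p i h ≢ p i′ h′

    succ-q-inner : ∀ (i : Fin m) s → (s ∈succ q (inject₁ i)) ⇔ (s ≡ q (fsuc i))
    succ-q-last  : ∀ s → (s ∈succ q (fromℕ m)) ⇔ (∃[ i ] s ≡ p i (0 mod j i))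
    succ-p       : ∀ i h s → (s ∈succ p i h) ⇔ (s ≡ p i (suc (toℕ h) mod j i))

-- Model of computation: the WHILE language of N. D. Jones ("Computability
-- and Complexity from a Programming Perspective") over binary trees with
-- one atom, with his unit-cost time measure.  Each operation takes constant
-- time on an implementation with trees as shared pointers, and polynomial
-- time is the same as for Turing machines.

data Tree : Set where
  nil  : Tree
  cons : Tree → Tree → Tree

∣_∣ᵗ : Tree → ℕ
∣ nil ∣ᵗ      = 1
∣ cons t u ∣ᵗ = suc (∣ t ∣ᵗ + ∣ u ∣ᵗ)

head tail : Tree → Tree
head nil        = nil
head (cons t _) = t
tail nil        = nil
tail (cons _ u) = u

Var : Set
Var = ℕ

data Expr : Set where
  var   : Var → Expr
  nil   : Expr
  cons  : Expr → Expr → Expr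
  hd tl : Expr → Expr

infix  5 _:=_
infixr 4 _⨾_

data Cmd : Set where
  skip             : Cmd
  _:=_             : Var → Expr → Cmd
  _⨾_              : Cmd → Cmd → Cmd
  if_then_else_end : Expr → Cmd → Cmd → Cmd
  while_loop_end   : Expr → Cmd → Cmd

Store : Set
Store = Var → Tree

_[_≔_] : Store → Var → Tree → Store
(σ [ x ≔ t ]) y = if y ≡ᵇ x then t else σ y

⟦_⟧ : Expr → Store → Tree
⟦ var x ⟧ σ    = σ x
⟦ nil ⟧ σ      = nil
⟦ cons d e ⟧ σ = cons (⟦ d ⟧ σ) (⟦ e ⟧ σ)
⟦ hd e ⟧ σ     = head (⟦ e ⟧ σ)
⟦ tl e ⟧ σ     = tail (⟦ e ⟧ σ)

cost : Expr → ℕ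
cost (var x)    = 1
cost nil        = 1
cost (cons d e) = suc (cost d + cost e)
cost (hd e)     = suc (cost e)
cost (tl e)     = suc (cost e)

infix 3 ⟨_,_⟩⇓⟨_,_⟩

-- ⟨ c , σ ⟩⇓⟨ σ′ , t ⟩: run from σ, the command c halts in σ′ after t units
-- of time.  As a condition, nil is false and every other tree is true.
data ⟨_,_⟩⇓⟨_,_⟩ : Cmd → Store → Store → ℕ → Set where
  ⇓skip   : ∀ {σ} → ⟨ skip , σ ⟩⇓⟨ σ , 1 ⟩
  ⇓assign : ∀ {σ x e} → ⟨ x := e , σ ⟩⇓⟨ σ [ x ≔ ⟦ e ⟧ σ ] , suc (cost e) ⟩
  ⇓seq    : ∀ {σ σ′ σ″ c d t u} →
            ⟨ c , σ ⟩⇓⟨ σ′ , t ⟩ → ⟨ d , σ′ ⟩⇓⟨ σ″ , u ⟩ →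
            ⟨ c ⨾ d , σ ⟩⇓⟨ σ″ , t + u ⟩
  ⇓then   : ∀ {σ σ′ e c d t} → ⟦ e ⟧ σ ≢ nil →
            ⟨ c , σ ⟩⇓⟨ σ′ , t ⟩ →
            ⟨ if e then c else d end , σ ⟩⇓⟨ σ′ , suc (cost e + t) ⟩
  ⇓else   : ∀ {σ σ′ e c d t} → ⟦ e ⟧ σ ≡ nil →
            ⟨ d , σ ⟩⇓⟨ σ′ , t ⟩ →
            ⟨ if e then c else d end , σ ⟩⇓⟨ σ′ , suc (cost e + t) ⟩
  ⇓done   : ∀ {σ e c} → ⟦ e ⟧ σ ≡ nil →
            ⟨ while e loop c end , σ ⟩⇓⟨ σ , suc (cost e) ⟩
  ⇓loop   : ∀ {σ σ′ σ″ e c t u} → ⟦ e ⟧ σ ≢ nil →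
            ⟨ c , σ ⟩⇓⟨ σ′ , t ⟩ →
            ⟨ while e loop c end , σ′ ⟩⇓⟨ σ″ , u ⟩ →
            ⟨ while e loop c end , σ ⟩⇓⟨ σ″ , suc (cost e + (t + u)) ⟩

-- Input and output are held in variable 0; all other variables start as nil.
inputStore : Tree → Store
inputStore t zero    = t
inputStore t (suc _) = nil

_on_outputs_within_ : Cmd → Tree → Tree → ℕ → Set
c on t outputs u within b =
  ∃[ σ ] ∃[ τ ] ((⟨ c , inputStore t ⟩⇓⟨ σ , τ ⟩) × σ 0 ≡ u × τ ≤ b)

encodeℕ : ℕ → Tree
encodeℕ zero    = nil
encodeℕ (suc n) = cons nil (encodeℕ n)

encodeList : List Tree → Tree
encodeList []       = nil
encodeList (t ∷ ts) = cons t (encodeList ts)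

-- Writing state names in unary keeps the encoding polynomial in the number
-- of states and transitions, because all states are listed.
encodeState : ∀ {n} → Fin n → Tree
encodeState q = encodeℕ (toℕ q)

encodeTransition : ∀ {n} → Fin n × Fin n → Tree
encodeTransition (q , q′) = cons (encodeState q) (encodeState q′)

encode : UnaryNFA → Tree
encode A =
  cons (encodeList (map encodeState (allFin size)))
    (cons (encodeList (map encodeTransition transitions))
      (cons (encodeState initial)
        (encodeList (map encodeState final))))
  where open UnaryNFA A

-- One program and one polynomial c · sᵈ + c for all inputs, where s is the
-- size of the encoded input.
PolynomialTime : (UnaryNFA → UnaryNFA) → Set
PolynomialTime f =
  ∃[ prog ] ∃[ c ] ∃[ d ] ∀ A →
    prog on encode A outputs encode (f A) within (c * ∣ encode A ∣ᵗ ^ d + c)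

{-# OPTIONS --safe #-}
module Submission where

open import Defs
open import Data.Fin using (Fin; toℕ; fromℕ; fromℕ<; inject₁; combine) renaming (zero to fzero; suc to fsuc)
open import Data.Fin.Induction using (<-weakInduction)
open import Data.Fin.Patterns using (0F; 1F; 2F)
open import Data.Fin.Properties
  using (pigeonhole; combine-injective; toℕ<n; toℕ-fromℕ<; toℕ-injective; toℕ-fromℕ; toℕ-inject₁)
open import Data.Fin.Relation.Unary.Top using (view; ‵fromℕ; ‵inject₁)
open import Data.List as List using (List; []; _∷_; tabulate; allFin)
open import Data.List.Membership.Propositional using (_∈_)
open import Data.List.Properties using (map-tabulate; length-map; length-tabulate)
open import Data.List.Relation.Unary.Any using (here; there)
open import Data.Nat using (ℕ; zero; suc; _+_; _*_; _∸_; _^_; _≤_; _<_; NonZero; z≤n; s≤s; s≤s⁻¹; _≟_; _≤?_; _<?_)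
open import Data.Nat.DivMod using (_%_; _/_; _mod_; m≡m%n+[m/n]*n; m%n<n; m<n⇒m%n≡m; n%n≡0; %-distribˡ-+; m%n%n≡m%n)
open import Data.Nat.Divisibility using (_∣_; divides; ∣m+n∣m⇒∣n; n∣m*n)
open import Data.Nat.Induction using (<-rec)
open import Data.Nat.Properties
open import Data.Nat.Tactic.RingSolver using (solve-∀)
open import Data.Product using (∃-syntax; _×_; _,_; proj₁; proj₂)
open import Data.Sum using (_⊎_; inj₁; inj₂; [_,_]′)
open import Data.Vec using (Vec; []; _∷_; lookup; map)
open import Data.Vec.Relation.Binary.Pointwise.Inductive as Pointwise using (Pointwise; []; _∷_)
open import Data.Vec.Relation.Unary.All using (All; []; _∷_)
open import Data.Vec.Relation.Unary.All.Properties using (lookup⁺)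
open import Function using (_∘_; id)
open import Function.Bundles using (_⇔_; mk⇔; Equivalence)
open import Relation.Binary.Definitions using (tri<; tri≈; tri>)
open import Relation.Binary.PropositionalEquality
open import Relation.Nullary using (yes; no; contradiction)
open import Relation.Nullary.Decidable using (dec-true; dec-false)
open Equivalence using (to; from)

-- Let n be the number of states and q₀ the initial state.  A walk of length
-- at least n closes a loop of some length j ≤ n among its first n steps; going
-- round this loop and shifting its base point puts a closed j-walk at time n
-- exactly.  Modulo j, what follows can be cut below length n j ≤ n², by the
-- pigeonhole principle for pairs of a state and a residue of the time, and it
-- can be lengthened by going round the loop.  So for m = n + n² and x > m, the
-- automaton accepts x iff there are j ≤ n, a state q and a final state f with
-- q₀ →ⁿ q →ʲ q →ᵇ f, where n + b is the number congruent to x modulo j among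
-- m + 1, …, m + j.  The normal form therefore has the stem 0, …, m and one
-- cycle of each length 1, …, n, and finality is reachability in a given number
-- of steps.

-- Taking a cycle of every length `1`, ..., `n`, instead of finding strongly connected components
-- and the gcds of their loops, costs only `n (n + 1) / 2` states. It is harmless: a closed walk can
-- be repeated at will, so no cycle accepts a wrong length. Fixing the base point at time exactly
-- `n` turns finality of a cycle state into one composition of reachability steps. The real obstacle
-- is the machine: the algorithm has to be a WHILE program with a proved time bound. It is written
-- in a small total language in which every loop runs along read-only data. One structural induction
-- then bounds the time of all programs in it, and correctness becomes an equation between trees.
-- Since computed numbers such as `n²` cannot drive loops, there are two stages, and the result of
-- the first is the read-only input of the second.

-- Polynomial growth.

-- Zero is excluded so that `b ^ d` grows with `d`; a sum then fits under one monomial whose degree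
-- is the sum of the degrees.
Polynomial : (ℕ → ℕ) → Set
Polynomial g = ∃[ c ] ∃[ d ] ∀ b → .{{NonZero b}} → g b ≤ c * b ^ d

polynomial-const : ∀ k → Polynomial (λ _ → k)
polynomial-const k = k , 0 , λ b → ≤-reflexive (sym (*-identityʳ k))

polynomial-id : Polynomial (λ b → b)
polynomial-id = 1 , 1 , λ b → ≤-reflexive (sym (trans (*-identityˡ _) (*-identityʳ b)))

polynomial-+ : ∀ {g h} → Polynomial g → Polynomial h → Polynomial (λ b → g b + h b)
polynomial-+ {g} {h} (c₁ , d₁ , g≤) (c₂ , d₂ , h≤) = c₁ + c₂ , d₁ + d₂ , λ b → begin
  g b + h b                                      ≤⟨ +-mono-≤ (g≤ b) (h≤ b) ⟩
  c₁ * b ^ d₁ + c₂ * b ^ d₂                      ≤⟨ +-mono-≤ (*-monoʳ-≤ c₁ (^-monoʳ-≤ b (m≤m+n d₁ d₂)))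
                                                             (*-monoʳ-≤ c₂ (^-monoʳ-≤ b (m≤n+m d₂ d₁))) ⟩
  c₁ * b ^ (d₁ + d₂) + c₂ * b ^ (d₁ + d₂)        ≡⟨ *-distribʳ-+ (b ^ (d₁ + d₂)) c₁ c₂ ⟨
  (c₁ + c₂) * b ^ (d₁ + d₂)                      ∎
  where open ≤-Reasoning

polynomial-* : ∀ {g h} → Polynomial g → Polynomial h → Polynomial (λ b → g b * h b)
polynomial-* {g} {h} (c₁ , d₁ , g≤) (c₂ , d₂ , h≤) = c₁ * c₂ , d₁ + d₂ , λ b → begin
  g b * h b                        ≤⟨ *-mono-≤ (g≤ b) (h≤ b) ⟩
  c₁ * b ^ d₁ * (c₂ * b ^ d₂)      ≡⟨ [m*n]*[o*p]≡[m*o]*[n*p] c₁ (b ^ d₁) c₂ (b ^ d₂) ⟩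
  c₁ * c₂ * (b ^ d₁ * b ^ d₂)      ≡⟨ cong (c₁ * c₂ *_) (^-distribˡ-+-* b d₁ d₂) ⟨
  c₁ * c₂ * b ^ (d₁ + d₂)          ∎
  where open ≤-Reasoning

^-distribʳ-* : ∀ m n o → (m * n) ^ o ≡ m ^ o * n ^ o
^-distribʳ-* m n zero    = refl
^-distribʳ-* m n (suc o) = trans (cong (m * n *_) (^-distribʳ-* m n o))
                                 ([m*n]*[o*p]≡[m*o]*[n*p] m n (m ^ o) (n ^ o))

-- The successor keeps the argument of `g` nonzero, as `Polynomial` demands.
polynomial-∘ : ∀ {g h} → Polynomial g → Polynomial h → Polynomial (λ b → g (suc (h b)))
polynomial-∘ {g} {h} (c₁ , d₁ , g≤) h-polynomial
  with c₂ , d₂ , h≤ ← polynomial-+ (polynomial-const 1) h-polynomial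
  = c₁ * c₂ ^ d₁ , d₂ * d₁ , λ b → begin
  g (suc (h b))                          ≤⟨ g≤ (suc (h b)) ⟩
  c₁ * suc (h b) ^ d₁                    ≤⟨ *-monoʳ-≤ c₁ (^-monoˡ-≤ d₁ (h≤ b)) ⟩
  c₁ * (c₂ * b ^ d₂) ^ d₁                ≡⟨ cong (c₁ *_) (^-distribʳ-* c₂ (b ^ d₂) d₁) ⟩
  c₁ * (c₂ ^ d₁ * (b ^ d₂) ^ d₁)         ≡⟨ *-assoc c₁ _ _ ⟨
  c₁ * c₂ ^ d₁ * (b ^ d₂) ^ d₁           ≡⟨ cong (c₁ * c₂ ^ d₁ *_) (^-*-assoc b d₂ d₁) ⟩
  c₁ * c₂ ^ d₁ * b ^ (d₂ * d₁)           ∎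
  where open ≤-Reasoning

-- A term language with polynomial-time evaluation.

-- A term sees read-only trees, accessed through views,
-- and working trees, which it may build freely.  As in the safe recursion of
-- Bellantoni and Cook, loops run only along views, hence along parts of the
-- read-only trees; this alone makes evaluation polynomial.

data View (r : ℕ) : Set where
  var   : Fin r → View r
  hd tl : View r → View r

-- fold v init body runs along the spine of v from its head.  In the body,
-- read-only variable 0 is the rest of v from the current entry on, and working
-- variable 0 is the accumulator.
data Term (r w : ℕ) : Set where
  read              : View r → Term r w
  var               : Fin w → Term r w
  nil               : Term r w
  cons              : Term r w → Term r w → Term r w
  hd tl             : Term r w → Term r w
  if_then_else_     : Term r w → Term r w → Term r w → Term r w
  fold              : View r → Term r w → Term (suc r) (suc w) → Term r w
  call              : ∀ {r′} → Term r′ 1 → Vec (View r) r′ → Term r w → Term r w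

cond : {A : Set} → Tree → A → A → A
cond nil        x y = y
cond (cons _ _) x y = x

-- The body receives the nonempty rest, not just its head. Along `encodeℕ k` it sees the numerals of
-- `k`, ..., `1`, so an index counted from 0 is the tail of what it sees.
foldᵗ : (Tree → Tree → Tree) → Tree → Tree → Tree
foldᵗ g nil          a = a
foldᵗ g t@(cons _ u) a = foldᵗ g u (g t a)

evalᵛ : ∀ {r} → View r → Vec Tree r → Tree
evalᵛ (var i) ρ = lookup ρ i
evalᵛ (hd v)  ρ = head (evalᵛ v ρ)
evalᵛ (tl v)  ρ = tail (evalᵛ v ρ)

eval : ∀ {r w} → Term r w → Vec Tree r → Vec Tree w → Tree
eval (read v)               ρ ς = evalᵛ v ρ
eval (var i)                ρ ς = lookup ς i
eval nil                    ρ ς = nil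
eval (cons s t)             ρ ς = cons (eval s ρ ς) (eval t ρ ς)
eval (hd t)                 ρ ς = head (eval t ρ ς)
eval (tl t)                 ρ ς = tail (eval t ρ ς)
eval (if c then s else t)   ρ ς = cond (eval c ρ ς) (eval s ρ ς) (eval t ρ ς)
eval (fold v init body)     ρ ς = foldᵗ (λ u a → eval body (u ∷ ρ) (a ∷ ς)) (evalᵛ v ρ) (eval init ρ ς)
eval (call f vs t)          ρ ς = eval f (map (λ v → evalᵛ v ρ) vs) (eval t ρ ς ∷ [])

-- Compilation to WHILE programs.

compileᵛ : ∀ {r} → Vec Var r → View r → Expr
compileᵛ rs (var i) = var (lookup rs i)
compileᵛ rs (hd v)  = hd (compileᵛ rs v)
compileᵛ rs (tl v)  = tl (compileᵛ rs v)

registers : Var → (k : ℕ) → Vec Var k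
registers d zero    = []
registers d (suc k) = k + d ∷ registers d k

load : ∀ {r k} → Vec Var r → Var → Vec (View r) k → Cmd
load             rs d []       = skip
load {k = suc k} rs d (v ∷ vs) = load rs d vs ⨾ k + d := compileᵛ rs v

-- The variables of the term live in registers below d, the value is left in
-- register d, and the registers above d are scratch.
compile : ∀ {r w} → Vec Var r → Vec Var w → Var → Term r w → Cmd
compile rs ws d (read v)             = d := compileᵛ rs v
compile rs ws d (var i)              = d := var (lookup ws i)
compile rs ws d nil                  = d := nil
compile rs ws d (cons s t)           = compile rs ws d s ⨾ compile rs ws (suc d) t ⨾
                                       d := cons (var d) (var (suc d))
compile rs ws d (hd t)               = compile rs ws d t ⨾ d := hd (var d)
compile rs ws d (tl t)               = compile rs ws d t ⨾ d := tl (var d)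
compile rs ws d (if c then s else t) = compile rs ws d c ⨾
                                       if var d then compile rs ws d s else compile rs ws d t end
compile rs ws d (fold v init body)   = d := compileᵛ rs v ⨾ compile rs ws (suc d) init ⨾
                                       while var d loop
                                         compile (d ∷ rs) (suc d ∷ ws) (2 + d) body ⨾
                                         suc d := var (2 + d) ⨾ d := tl (var d)
                                       end ⨾
                                       d := var (suc d)
compile rs ws d (call {k} f vs t)    = compile rs ws d t ⨾ load rs (suc d) vs ⨾
                                       compile (registers (suc d) k) (d ∷ []) (k + suc d) f ⨾
                                       d := var (k + suc d)

-- Time bounds of compiled terms.

costᵛ : ∀ {r} → View r → ℕ
costᵛ (var i) = 1
costᵛ (hd v)  = suc (costᵛ v)
costᵛ (tl v)  = suc (costᵛ v)

loadTime : ∀ {r k} → Vec (View r) k → ℕ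
loadTime []       = 1
loadTime (v ∷ vs) = loadTime vs + suc (costᵛ v)

-- b bounds the sizes of the read-only trees, and hence the number of rounds
-- of every loop.
timeBound : ∀ {r w} → Term r w → ℕ → ℕ
timeBound (read v)             b = suc (costᵛ v)
timeBound (var i)              b = 2
timeBound nil                  b = 2
timeBound (cons s t)           b = timeBound s b + (timeBound t b + 4)
timeBound (hd t)               b = timeBound t b + 3
timeBound (tl t)               b = timeBound t b + 3
-- Both branches are counted: the sum bounds either one and is again polynomial.
timeBound (if c then s else t) b = timeBound c b + (2 + (timeBound s b + timeBound t b))
-- A round costs 2 for the test and 2 + 3 for the assignments after the body. The last two 2s are
-- the failing test and the copy of the accumulator.
timeBound (fold v init body)   b = suc (costᵛ v) + (timeBound init b + (b * (2 + (timeBound body b + 5)) + 2 + 2))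
timeBound (call f vs t)        b = timeBound t b + (loadTime vs + (timeBound f b + 2))

timeBound-polynomial : ∀ {r w} (t : Term r w) → Polynomial (timeBound t)
timeBound-polynomial (read v)   = polynomial-const (suc (costᵛ v))
timeBound-polynomial (var i)    = polynomial-const 2
timeBound-polynomial nil        = polynomial-const 2
timeBound-polynomial (cons s t) =
  polynomial-+ (timeBound-polynomial s) (polynomial-+ (timeBound-polynomial t) (polynomial-const 4))
timeBound-polynomial (hd t)     = polynomial-+ (timeBound-polynomial t) (polynomial-const 3)
timeBound-polynomial (tl t)     = polynomial-+ (timeBound-polynomial t) (polynomial-const 3)
timeBound-polynomial (if c then s else t) =
  polynomial-+ (timeBound-polynomial c)
    (polynomial-+ (polynomial-const 2) (polynomial-+ (timeBound-polynomial s) (timeBound-polynomial t)))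
timeBound-polynomial (fold v init body) =
  polynomial-+ (polynomial-const (suc (costᵛ v)))
    (polynomial-+ (timeBound-polynomial init)
      (polynomial-+
        (polynomial-+
          (polynomial-* polynomial-id
            (polynomial-+ (polynomial-const 2)
              (polynomial-+ (timeBound-polynomial body) (polynomial-const 5))))
          (polynomial-const 2))
        (polynomial-const 2)))
timeBound-polynomial (call f vs t) =
  polynomial-+ (timeBound-polynomial t)
    (polynomial-+ (polynomial-const (loadTime vs)) (polynomial-+ (timeBound-polynomial f) (polynomial-const 2)))

-- Correctness of the compilation.

update-same : ∀ (σ : Store) x t → (σ [ x ≔ t ]) x ≡ t
update-same σ x t rewrite dec-true (x ≟ x) refl = refl

update-other : ∀ (σ : Store) {x y} t → y ≢ x → (σ [ x ≔ t ]) y ≡ σ y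
update-other σ {x} {y} t y≢x rewrite dec-false (y ≟ x) y≢x = refl

update-below : ∀ (σ : Store) {x y} t → y < x → (σ [ x ≔ t ]) y ≡ σ y
update-below σ t y<x = update-other σ t (<⇒≢ y<x)

Unchanged< : Var → Store → Store → Set
Unchanged< d σ σ′ = ∀ y → y < d → σ′ y ≡ σ y

unchanged-trans : ∀ {d e σ σ′ σ″} → d ≤ e → Unchanged< d σ σ′ → Unchanged< e σ′ σ″ → Unchanged< d σ σ″
unchanged-trans d≤e u v y y<d = trans (v y (<-≤-trans y<d d≤e)) (u y y<d)

Holds : Store → Var → Var → Tree → Set
Holds σ d x t = x < d × σ x ≡ t

_⊨_≔_below_ : ∀ {k} → Store → Vec Var k → Vec Tree k → Var → Set
σ ⊨ xs ≔ ts below d = Pointwise (Holds σ d) xs ts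

holds-mono : ∀ {k σ σ′ d e} {xs : Vec Var k} {ts} → d ≤ e → Unchanged< d σ σ′ →
             σ ⊨ xs ≔ ts below d → σ′ ⊨ xs ≔ ts below e
holds-mono d≤e u = Pointwise.map λ (x<d , σx≡t) → <-≤-trans x<d d≤e , trans (u _ x<d) σx≡t

record Computes (c : Cmd) (σ : Store) (d : Var) (v : Tree) (b : ℕ) : Set where
  field
    {after}   : Store
    {time}    : ℕ
    run       : ⟨ c , σ ⟩⇓⟨ after , time ⟩
    result    : after d ≡ v
    unchanged : Unchanged< d σ after
    within    : time ≤ b

open Computes

compileᵛ-correct : ∀ {r} (v : View r) {rs ρ σ d} → σ ⊨ rs ≔ ρ below d → ⟦ compileᵛ rs v ⟧ σ ≡ evalᵛ v ρ
compileᵛ-correct (var i) h = proj₂ (Pointwise.lookup h i)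
compileᵛ-correct (hd v)  h = cong head (compileᵛ-correct v h)
compileᵛ-correct (tl v)  h = cong tail (compileᵛ-correct v h)

cost-compileᵛ : ∀ {r} (v : View r) rs → cost (compileᵛ rs v) ≡ costᵛ v
cost-compileᵛ (var i) rs = refl
cost-compileᵛ (hd v)  rs = cong suc (cost-compileᵛ v rs)
cost-compileᵛ (tl v)  rs = cong suc (cost-compileᵛ v rs)

head-size : ∀ t → ∣ head t ∣ᵗ ≤ ∣ t ∣ᵗ
head-size nil        = ≤-refl
head-size (cons t u) = m≤n⇒m≤1+n (m≤m+n ∣ t ∣ᵗ ∣ u ∣ᵗ)

tail-size : ∀ t → ∣ tail t ∣ᵗ ≤ ∣ t ∣ᵗ
tail-size nil        = ≤-refl
tail-size (cons t u) = m≤n⇒m≤1+n (m≤n+m ∣ u ∣ᵗ ∣ t ∣ᵗ)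

SizesBoundedBy : ∀ {r} → ℕ → Vec Tree r → Set
SizesBoundedBy b = All (λ t → ∣ t ∣ᵗ ≤ b)

evalᵛ-size : ∀ {r} (v : View r) {ρ b} → SizesBoundedBy b ρ → ∣ evalᵛ v ρ ∣ᵗ ≤ b
evalᵛ-size (var i) small = lookup⁺ small i
evalᵛ-size (hd v)  small = ≤-trans (head-size _) (evalᵛ-size v small)
evalᵛ-size (tl v)  small = ≤-trans (tail-size _) (evalᵛ-size v small)

evalᵛ-sizes : ∀ {r k} (vs : Vec (View r) k) {ρ b} → SizesBoundedBy b ρ →
              SizesBoundedBy b (map (λ v → evalᵛ v ρ) vs)
evalᵛ-sizes []       small = []
evalᵛ-sizes (v ∷ vs) small = evalᵛ-size v small ∷ evalᵛ-sizes vs small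

assign-computes : ∀ {σ d v} e → ⟦ e ⟧ σ ≡ v → Computes (d := e) σ d v (suc (cost e))
assign-computes {σ} {d} {v} e eq = record
  { run       = ⇓assign
  ; result    = trans (update-same σ d _) eq
  ; unchanged = λ y y<d → update-below σ _ y<d
  ; within    = ≤-refl
  }

seq-computes : ∀ {c c′ σ d e v v′ b b′} → d ≤ e → (p : Computes c σ e v b) →
               Computes c′ (after p) d v′ b′ → Computes (c ⨾ c′) σ d v′ (b + b′)
seq-computes d≤e p q = record
  { run       = ⇓seq (run p) (run q)
  ; result    = result q
  ; unchanged = λ y y<d → trans (unchanged q y y<d) (unchanged p y (<-≤-trans y<d d≤e))
  ; within    = +-mono-≤ (within p) (within q)
  }

record Loads {k} (c : Cmd) (σ : Store) (d : Var) (ts : Vec Tree k) (b : ℕ) : Set where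
  field
    {after}   : Store
    run       : ⟨ c , σ ⟩⇓⟨ after , b ⟩
    results   : after ⊨ registers d k ≔ ts below (k + d)
    unchanged : Unchanged< d σ after

load-correct : ∀ {r k} (vs : Vec (View r) k) {rs ρ σ d} → σ ⊨ rs ≔ ρ below d →
               Loads (load rs d vs) σ d (map (λ v → evalᵛ v ρ) vs) (loadTime vs)
load-correct []       h = record { run = ⇓skip ; results = [] ; unchanged = λ _ _ → refl }
load-correct {k = suc k} (v ∷ vs) {rs} {ρ} {σ} {d} h = record
  { run       = subst (λ b → ⟨ load rs d (v ∷ vs) , σ ⟩⇓⟨ σ″ , loadTime vs + suc b ⟩)
                      (cost-compileᵛ v rs) (⇓seq (Loads.run p) ⇓assign)
  ; results   = (≤-refl , trans (update-same σ′ (k + d) _) (compileᵛ-correct v (holds-mono ≤-refl (Loads.unchanged p) h)))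
                ∷ holds-mono (n≤1+n _) (λ _ → update-below σ′ _) (Loads.results p)
  ; unchanged = unchanged-trans (m≤n+m d k) (Loads.unchanged p) (λ _ → update-below σ′ _)
  }
  where
  p  = load-correct vs h
  σ′ = Loads.after p
  σ″ = σ′ [ k + d ≔ ⟦ compileᵛ rs v ⟧ σ′ ]

branch-computes : ∀ {c s t σ d} v {x y bc bs bt} (p : Computes c σ d v bc) →
                  Computes s (after p) d x bs → Computes t (after p) d y bt →
                  Computes (c ⨾ if var d then s else t end) σ d (cond v x y) (bc + (2 + (bs + bt)))
branch-computes nil {bs = bs} {bt} p q q′ = seq-computes ≤-refl p record
  { run       = ⇓else (result p) (run q′)
  ; result    = result q′
  ; unchanged = unchanged q′
  ; within    = s≤s (s≤s (≤-trans (within q′) (m≤n+m bt bs)))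
  }
branch-computes (cons _ _) {bs = bs} {bt} p q q′ = seq-computes ≤-refl p record
  { run       = ⇓then (λ eq → contradiction (trans (sym (result p)) eq) λ ()) (run q)
  ; result    = result q
  ; unchanged = unchanged q
  ; within    = s≤s (s≤s (≤-trans (within q) (m≤m+n bs bt)))
  }

-- Differs from `Computes` in the register of the result: the loop consumes its list in `d` and
-- accumulates in `suc d`.
record LoopComputes (c : Cmd) (σ : Store) (d : Var) (v : Tree) (b : ℕ) : Set where
  field
    {after}   : Store
    {time}    : ℕ
    run       : ⟨ while var d loop c end , σ ⟩⇓⟨ after , time ⟩
    result    : after (suc d) ≡ v
    unchanged : Unchanged< d σ after
    within    : time ≤ b

-- Only the read-only trees are bounded in size. Working trees may grow exponentially by repeated
-- doubling, but no loop runs along them and each operation on them has constant cost. Values still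
-- needed survive because later subterms are compiled at higher registers and leave the lower ones
-- unchanged.
compile-correct : ∀ {r w} (t : Term r w) {rs ws ρ ς σ d b} → SizesBoundedBy b ρ →
                  σ ⊨ rs ≔ ρ below d → σ ⊨ ws ≔ ς below d →
                  Computes (compile rs ws d t) σ d (eval t ρ ς) (timeBound t b)

-- Each round removes a `cons` from `u`, so the size of `u` pays for all rounds. The rest stays
-- within `b` and may be handed to the body as a read-only tree.
loop-correct : ∀ {r w} (body : Term (suc r) (suc w)) {rs ws ρ ς d b} → SizesBoundedBy b ρ →
               ∀ u a {σ} → ∣ u ∣ᵗ ≤ b → σ d ≡ u → σ (suc d) ≡ a →
               σ ⊨ rs ≔ ρ below d → σ ⊨ ws ≔ ς below d →
               LoopComputes (compile (d ∷ rs) (suc d ∷ ws) (2 + d) body ⨾ suc d := var (2 + d) ⨾ d := tl (var d))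
                 σ d (foldᵗ (λ u a → eval body (u ∷ ρ) (a ∷ ς)) u a) (∣ u ∣ᵗ * (2 + (timeBound body b + 5)) + 2)

compile-correct (read v) {rs} {σ = σ} {d} small h h′ =
  subst (Computes _ σ d _) (cong suc (cost-compileᵛ v rs))
    (assign-computes (compileᵛ rs v) (compileᵛ-correct v h))
compile-correct (var i) {ws = ws} small h h′ = assign-computes (var (lookup ws i)) (proj₂ (Pointwise.lookup h′ i))
compile-correct nil small h h′ = assign-computes nil refl
compile-correct (cons s t) {d = d} small h h′ =
  seq-computes ≤-refl p (seq-computes (n≤1+n d) q
    (assign-computes (cons (var d) (var (suc d))) (cong₂ cons (trans (unchanged q d ≤-refl) (result p)) (result q))))
  where
  p = compile-correct s small h h′
  q = compile-correct t small (holds-mono (n≤1+n d) (unchanged p) h) (holds-mono (n≤1+n d) (unchanged p) h′)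
compile-correct (hd t) {d = d} small h h′ =
  seq-computes ≤-refl p (assign-computes (hd (var d)) (cong head (result p)))
  where p = compile-correct t small h h′
compile-correct (tl t) {d = d} small h h′ =
  seq-computes ≤-refl p (assign-computes (tl (var d)) (cong tail (result p)))
  where p = compile-correct t small h h′
compile-correct (if c then s else t) {d = d} small h h′ =
  branch-computes _ p
    (compile-correct s small (holds-mono ≤-refl (unchanged p) h) (holds-mono ≤-refl (unchanged p) h′))
    (compile-correct t small (holds-mono ≤-refl (unchanged p) h) (holds-mono ≤-refl (unchanged p) h′))
  where p = compile-correct c small h h′
compile-correct (fold v init body) {rs} {ws} {ρ} {ς} {σ} {d} {b} small h h′ = record
  { run       = ⇓seq ⇓assign (⇓seq (run q) (⇓seq (LoopComputes.run l) ⇓assign))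
  ; result    = trans (update-same (LoopComputes.after l) d _) (LoopComputes.result l)
  ; unchanged = unchanged-trans ≤-refl (unchanged-trans ≤-refl (unchanged p)
                  (unchanged-trans (n≤1+n d) (λ _ _ → refl) (unchanged q)))
                  (unchanged-trans ≤-refl (LoopComputes.unchanged l) (λ y → update-below (LoopComputes.after l) _))
  ; within    = +-mono-≤ (s≤s (≤-reflexive (cost-compileᵛ v rs))) (+-mono-≤ (within q)
                  (+-monoˡ-≤ 2 (≤-trans (LoopComputes.within l)
                    (+-monoˡ-≤ 2 (*-monoˡ-≤ (2 + (timeBound body b + 5)) (evalᵛ-size v small))))))
  }
  where
  p = assign-computes {σ} {d} (compileᵛ rs v) (compileᵛ-correct v h)
  q = compile-correct init small (holds-mono (n≤1+n d) (unchanged p) h) (holds-mono (n≤1+n d) (unchanged p) h′)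
  u = unchanged-trans {e = suc d} (n≤1+n d) (unchanged p) (unchanged q)
  l = loop-correct body small (evalᵛ v ρ) (eval init ρ ς) (evalᵛ-size v small)
        (trans (unchanged q d ≤-refl) (result p)) (result q)
        (holds-mono ≤-refl u h) (holds-mono ≤-refl u h′)
compile-correct (call {k} f vs t) {rs} {σ = σ} {d} {b} small h h′ = record
  { run       = ⇓seq (run p) (⇓seq (Loads.run l) (⇓seq (run q) ⇓assign))
  ; result    = trans (update-same (after q) d _) (result q)
  ; unchanged = unchanged-trans ≤-refl (unchanged p)
                  (unchanged-trans ≤-refl (unchanged-trans (n≤1+n d) (λ _ _ → refl) (Loads.unchanged l))
                    (unchanged-trans ≤-refl (unchanged-trans d≤k+1+d (λ _ _ → refl) (unchanged q))
                      (λ y → update-below (after q) _)))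
  ; within    = +-mono-≤ (within p) (+-monoʳ-≤ (loadTime vs) (+-monoˡ-≤ 2 (within q)))
  }
  where
  d≤k+1+d = ≤-trans (n≤1+n d) (m≤n+m (suc d) k)
  p = compile-correct t small h h′
  l = load-correct vs (holds-mono (n≤1+n d) (unchanged p) h)
  q = compile-correct f (evalᵛ-sizes vs small) (Loads.results l)
        ((m≤n+m (suc d) k , trans (Loads.unchanged l d ≤-refl) (result p)) ∷ [])

loop-correct body small nil a u≤b σd≡u σd′≡a h h′ = record
  { run = ⇓done σd≡u ; result = σd′≡a ; unchanged = λ _ _ → refl ; within = m≤n+m 2 (1 * (2 + (timeBound body _ + 5))) }
loop-correct body {d = d} {b} small (cons t u) a {σ} size≤b σd≡u σd′≡a h h′ = record
  { run       = ⇓loop (λ eq → contradiction (trans (sym σd≡u) eq) λ ())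
                  (⇓seq (run p) (⇓seq ⇓assign ⇓assign)) (LoopComputes.run l)
  ; result    = LoopComputes.result l
  ; unchanged = unchanged-trans ≤-refl unchanged₂ (LoopComputes.unchanged l)
  ; within    = within-round
  }
  where
  round = 2 + (timeBound body b + 5)
  d≤d+2 = m≤n+m d 2
  p = compile-correct body (size≤b ∷ small)
        ((n≤1+n (suc d) , σd≡u) ∷ holds-mono d≤d+2 (λ _ _ → refl) h)
        ((≤-refl , σd′≡a) ∷ holds-mono d≤d+2 (λ _ _ → refl) h′)
  σ₁ = after p [ suc d ≔ after p (2 + d) ]
  σ₂ = σ₁ [ d ≔ tail (σ₁ d) ]
  unchanged₂ : Unchanged< d σ σ₂
  unchanged₂ y y<d = begin
    σ₂ y       ≡⟨ update-below σ₁ _ y<d ⟩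
    σ₁ y       ≡⟨ update-below (after p) _ (m<n⇒m<1+n y<d) ⟩
    after p y  ≡⟨ unchanged p y (<-≤-trans y<d d≤d+2) ⟩
    σ y        ∎
    where open ≡-Reasoning
  σ₂d≡u : σ₂ d ≡ u
  σ₂d≡u = begin
    σ₂ d                ≡⟨ update-same σ₁ d _ ⟩
    tail (σ₁ d)         ≡⟨ cong tail (update-below (after p) _ ≤-refl) ⟩
    tail (after p d)    ≡⟨ cong tail (unchanged p d (n≤1+n (suc d))) ⟩
    tail (σ d)          ≡⟨ cong tail σd≡u ⟩
    u                   ∎
    where open ≡-Reasoning
  σ₂d′≡ : σ₂ (suc d) ≡ _
  σ₂d′≡ = trans (update-other σ₁ _ 1+n≢n) (trans (update-same (after p) (suc d) _) (result p))
  l = loop-correct body small u _ (≤-trans (m≤n⇒m≤1+n (m≤n+m ∣ u ∣ᵗ ∣ t ∣ᵗ)) size≤b) σ₂d≡u σ₂d′≡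
        (holds-mono ≤-refl unchanged₂ h) (holds-mono ≤-refl unchanged₂ h′)
  within-round : suc (1 + (time p + (2 + 3) + LoopComputes.time l)) ≤ ∣ cons t u ∣ᵗ * round + 2
  within-round = begin
    suc (1 + (time p + (2 + 3) + LoopComputes.time l))
      ≤⟨ s≤s (s≤s (+-mono-≤ (+-monoˡ-≤ 5 (within p)) (LoopComputes.within l))) ⟩
    round + (∣ u ∣ᵗ * round + 2)
      ≡⟨ +-assoc round (∣ u ∣ᵗ * round) 2 ⟨
    suc ∣ u ∣ᵗ * round + 2
      ≤⟨ +-monoˡ-≤ 2 (*-monoˡ-≤ round (s≤s (m≤n+m ∣ u ∣ᵗ ∣ t ∣ᵗ))) ⟩
    ∣ cons t u ∣ᵗ * round + 2 ∎
    where open ≤-Reasoning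

-- Residues, and the walks of a unary NFA.

toℕ-mod : ∀ m n .{{_ : NonZero n}} → toℕ (m mod n) ≡ m % n
toℕ-mod m n = toℕ-fromℕ< (m%n<n m n)

%-≡⇒∣ : ∀ m d n .{{_ : NonZero n}} → m % n ≡ (m + d) % n → n ∣ d
%-≡⇒∣ m d n m%n≡ = ∣m+n∣m⇒∣n (divides ((m + d) / n) (+-cancelˡ-≡ (m % n) _ _ eq)) (n∣m*n (m / n))
  where
  open ≡-Reasoning
  eq : m % n + (m / n * n + d) ≡ m % n + (m + d) / n * n
  eq = begin
    m % n + (m / n * n + d)              ≡⟨ +-assoc (m % n) _ d ⟨
    m % n + m / n * n + d                ≡⟨ cong (_+ d) (m≡m%n+[m/n]*n m n) ⟨
    m + d                                ≡⟨ m≡m%n+[m/n]*n (m + d) n ⟩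
    (m + d) % n + (m + d) / n * n        ≡⟨ cong (_+ (m + d) / n * n) m%n≡ ⟨
    m % n + (m + d) / n * n              ∎

module Paths (A : UnaryNFA) where
  open UnaryNFA A

  relength : ∀ {x y q r} → x ≡ y → Path x q r → Path y q r
  relength refl π = π

  infixr 5 _++_
  _++_ : ∀ {x y q r s} → Path x q r → Path y r s → Path (x + y) q s
  stay     ++ π′ = π′
  step e π ++ π′ = step e (π ++ π′)

  snoc : ∀ {x q r s} → Path x q r → s ∈succ r → Path (suc x) q s
  snoc stay       e  = step e stay
  snoc (step e π) e′ = step e (snoc π e′)

  power : ∀ {j u} → Path j u u → ∀ k → Path (k * j) u u
  power π zero    = stay
  power π (suc k) = π ++ power π k

  -- Beyond its end a walk stays at its last state, which makes positions total on the natural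
  -- numbers.
  at : ∀ {x q r} → Path x q r → ℕ → State
  at {q = q} stay       i       = q
  at {q = q} (step e π) zero    = q
  at         (step e π) (suc i) = at π i

  prefix : ∀ {x q r} (π : Path x q r) {i} → i ≤ x → Path i q (at π i)
  prefix stay       z≤n       = stay
  prefix (step e π) z≤n       = stay
  prefix (step e π) (s≤s i≤x) = step e (prefix π i≤x)

  suffix : ∀ {x q r} (π : Path x q r) {i} → i ≤ x → Path (x ∸ i) (at π i) r
  suffix stay       z≤n       = stay
  suffix (step e π) z≤n       = step e π
  suffix (step e π) (s≤s i≤x) = suffix π i≤x

  segment : ∀ {x q r} (π : Path x q r) {i k} → i ≤ k → k ≤ x → Path (k ∸ i) (at π i) (at π k)
  segment stay       z≤n       z≤n       = stay
  segment (step e π) z≤n       k≤x       = prefix (step e π) k≤x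
  segment (step e π) (s≤s i≤k) (s≤s k≤x) = segment π i≤k k≤x

  -- The colour has two uses: residues modulo `j` make the length of the loop a multiple of `j`,
  -- while a single colour asks for nothing but a repeated state.
  record Loop (x bound : ℕ) {j} (c : ℕ → Fin j) (q r : State) : Set where
    field
      {before length after} : ℕ
      {u}                   : State
      π₁                    : Path before q u
      π₂                    : Path (suc length) u u
      π₃                    : Path after u r
      total                 : x ≡ before + (suc length + after)
      within                : before + suc length ≤ bound
      same-colour           : c before ≡ c (before + suc length)

  -- The `size * j + 1` positions `0`, ..., `size * j` carry one of `size * j` pairs of a state and
  -- a colour, so two of them agree.
  findLoop : ∀ {x q r j} (c : ℕ → Fin j) → size * j ≤ x → Path x q r → Loop x (size * j) c q r
  findLoop {x} {j = j} c size*j≤x π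
    with i , k , i<k , same ← pigeonhole (n<1+n (size * j)) (λ i → combine (at π (toℕ i)) (c (toℕ i)))
    with at-i≡at-k , c-i≡c-k ← combine-injective (at π (toℕ i)) (c (toℕ i)) (at π (toℕ k)) (c (toℕ k)) same
    with l , k≡i+1+l ← m≤n⇒∃[o]m+o≡n i<k
    = record
    { π₁          = prefix π (≤-trans (<⇒≤ i<k) k≤x)
    ; π₂          = subst₂ (λ y u → Path y (at π (toℕ i)) u) k∸i≡1+l (sym at-i≡at-k) (segment π (<⇒≤ i<k) k≤x)
    ; π₃          = subst (λ u → Path (x ∸ toℕ k) u _) (sym at-i≡at-k) (suffix π k≤x)
    ; total       = trans (sym (m+[n∸m]≡n k≤x))
                      (trans (cong (_+ (x ∸ toℕ k)) k≡i+[1+l]) (+-assoc (toℕ i) (suc l) _))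
    ; within      = ≤-trans (≤-reflexive (sym k≡i+[1+l])) k≤size*j
    ; same-colour = trans c-i≡c-k (cong c k≡i+[1+l])
    }
    where
    k≤size*j : toℕ k ≤ size * j
    k≤size*j = s≤s⁻¹ (toℕ<n k)
    k≤x : toℕ k ≤ x
    k≤x = ≤-trans k≤size*j size*j≤x
    k≡i+[1+l] : toℕ k ≡ toℕ i + suc l
    k≡i+[1+l] = trans (sym k≡i+1+l) (sym (+-suc (toℕ i) l))
    k∸i≡1+l : toℕ k ∸ toℕ i ≡ suc l
    k∸i≡1+l = trans (cong (_∸ toℕ i) k≡i+[1+l]) (m+n∸m≡n (toℕ i) (suc l))

  -- Cut out a closed subwalk as long as two positions congruent modulo j carry
  -- the same state.
  shorten : ∀ j .{{_ : NonZero j}} x {q r} → Path x q r →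
            ∃[ y ] ∃[ k ] (y < size * j × x ≡ y + k * j × Path y q r)
  shorten j = <-rec (λ x → Shortened x) cut
    where
    Shortened : ℕ → Set
    Shortened x = ∀ {q r} → Path x q r → ∃[ y ] ∃[ k ] (y < size * j × x ≡ y + k * j × Path y q r)
    cut : ∀ x → (∀ {y} → y < x → Shortened y) → Shortened x
    cut x rec π with size * j ≤? x
    ... | no  size*j≰x = x , 0 , ≰⇒> size*j≰x , sym (+-identityʳ x) , π
    ... | yes size*j≤x with findLoop (_mod j) size*j≤x π
    ... | record { before = a ; length = l ; after = z ; π₁ = π₁ ; π₃ = π₃ ; total = refl ; same-colour = same }
      with divides k 1+l≡k*j ← %-≡⇒∣ a (suc l) j
             (trans (sym (toℕ-mod a j)) (trans (cong toℕ same) (toℕ-mod (a + suc l) j)))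
      with y , k′ , y< , eq , π′ ← rec {a + z} (+-monoʳ-< a (s≤s (m≤n+m z l))) (π₁ ++ π₃)
      = y , k + k′ , y< , length≡ , π′
      where
      open ≡-Reasoning
      length≡ : a + (suc l + z) ≡ y + (k + k′) * j
      length≡ = begin
        a + (suc l + z)         ≡⟨ cong (λ t → a + (t + z)) 1+l≡k*j ⟩
        a + (k * j + z)         ≡⟨ swap a (k * j) z ⟩
        k * j + (a + z)         ≡⟨ cong (k * j +_) eq ⟩
        k * j + (y + k′ * j)    ≡⟨ collect k k′ j y ⟩
        y + (k + k′) * j        ∎
        where
        swap : ∀ a b c → a + (b + c) ≡ b + (a + c)
        swap = solve-∀
        collect : ∀ k k′ j y → k * j + (y + k′ * j) ≡ y + (k + k′) * j
        collect = solve-∀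

  -- Moving the first edge to the end shifts the base point by one, and the rest `π` of the old loop
  -- leads from the new base point back to the old one. Each shift thus adds `1 + j`, a full round,
  -- to `e + b`.
  rotate : ∀ e {j u} → Path (suc j) u u →
           ∃[ q ] ∃[ b ] ∃[ k ] (Path e u q × Path (suc j) q q × Path b q u × e + b ≡ k * suc j)
  rotate zero    {u = u} γ = u , 0 , 0 , stay , γ , stay , refl
  rotate (suc e) {j} (step edge π)
    with q , b , k , π₁ , γ , π₂ , eq ← rotate e (snoc π edge)
    = q , b + j , suc k , step edge π₁ , γ , π₂ ++ π ,
      trans (regroup e b j) (cong (suc j +_) eq)
    where
    regroup : ∀ e b j → suc e + (b + j) ≡ suc j + (e + b)
    regroup = solve-∀

  AcceptsThroughCycle : ℕ → ℕ → ℕ → Set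
  AcceptsThroughCycle a j b = ∃[ q ] ∃[ f ] (f ∈ final × Path a initial q × Path j q q × Path b q f)

  -- Going round the closed walk `y / j` times makes up for the difference between `y % j` and `y`,
  -- whichever closed walk was found.
  throughCycle-sound : ∀ {a j b} y .{{_ : NonZero j}} →
                       AcceptsThroughCycle a j (b + suc (y % j)) → Accepts (a + (b + suc y))
  throughCycle-sound {a} {j} {b} y (q , f , f∈final , α , γ , β) =
    f , f∈final , relength length≡ (α ++ power γ (y / j) ++ β)
    where
    open ≡-Reasoning
    length≡ : a + (y / j * j + (b + suc (y % j))) ≡ a + (b + suc y)
    length≡ = begin
      a + (y / j * j + (b + suc (y % j)))    ≡⟨ regroup a (y / j * j) b (y % j) ⟩
      a + (b + suc (y % j + y / j * j))      ≡⟨ cong (λ t → a + (b + suc t)) (m≡m%n+[m/n]*n y j) ⟨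
      a + (b + suc y)                        ∎
      where
      regroup : ∀ a d b r → a + (d + (b + suc r)) ≡ a + (b + suc (r + d))
      regroup = solve-∀

  -- Among its first size steps an accepting walk closes a loop at some u.
  -- Going round the loop up to time size exactly, and then back to u, changes
  -- the length only by a multiple of the length of the loop.
  throughCycle-complete : ∀ y → Accepts (size + (size * size + suc y)) →
    ∃[ i ] AcceptsThroughCycle size (suc (toℕ {size} i)) (size * size + suc (y % suc (toℕ i)))
  throughCycle-complete y (f , f∈final , π)
    -- With a single colour only the state has to repeat, so a loop closes within `size * 1` steps.
    with record { before = a ; length = l ; after = z ; π₁ = α ; π₂ = γ ; π₃ = ω ; total = total ; within = within }
           ← findLoop (λ _ → fzero {0}) (≤-trans (≤-reflexive (*-identityʳ size)) (m≤m+n size _)) π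
    with e , a+e≡size ← m≤n⇒∃[o]m+o≡n (≤-trans (m≤m+n a (suc l)) (≤-trans within (≤-reflexive (*-identityʳ size))))
    with q , b , k , α′ , γ′ , β , e+b≡ ← rotate e γ
    with c , k′ , c< , b+z≡ , β′ ← shorten (suc l) (b + z) (β ++ ω)
    -- The loop length is at most `size`, so `c < size * size`: the shortened tail is too short by
    -- some `d`, to be filled with rounds of `γ′`. This is where the `n²` steps of the stem are
    -- spent.
    with d , c+d≡ ← m≤n⇒∃[o]m+o≡n (≤-trans (<⇒≤ c<) (≤-trans (*-monoʳ-≤ size
                      (≤-trans (m≤n+m (suc l) a) (≤-trans within (≤-reflexive (*-identityʳ size)))))
                      (m≤m+n (size * size) (suc (y % suc l)))))
    = fromℕ< l<size ,
      subst (λ l → AcceptsThroughCycle size (suc l) (size * size + suc (y % suc l))) (sym (toℕ-fromℕ< l<size))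
        ( q , f , f∈final , relength a+e≡size (α ++ α′) , γ′
        , relength (trans (+-comm (_∣_.quotient j∣d * j) c) (trans (cong (c +_) (sym (_∣_.equality j∣d))) c+d≡))
            (power γ′ (_∣_.quotient j∣d) ++ β′))
    where
    open ≡-Reasoning
    j = suc l
    l<size : l < size
    l<size = ≤-trans (m≤n+m j a) (≤-trans within (≤-reflexive (*-identityʳ size)))
    regroup₁ : ∀ s c d w k → s + c + ((w + k) + d) ≡ s + (c + d + w) + k
    regroup₁ = solve-∀
    regroup₂ : ∀ s w r → s + suc (r + w) ≡ s + suc r + w
    regroup₂ = solve-∀
    regroup₃ : ∀ a e b j z → a + (j + z) + (e + b) ≡ a + e + (j + (b + z))
    regroup₃ = solve-∀
    regroup₄ : ∀ s j c k′ → s + (j + (c + k′ * j)) ≡ s + c + (suc k′ * j)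
    regroup₄ = solve-∀
    -- The length of the original walk is expressed in two ways and `e + b ≡ k * j` is added. All
    -- terms but `d` cancel or are multiples of `j`.
    balance : size + c + ((y / j * j + k * j) + d) ≡ size + c + suc k′ * j
    balance = begin
      size + c + ((y / j * j + k * j) + d)               ≡⟨ regroup₁ size c d (y / j * j) (k * j) ⟩
      size + (c + d + y / j * j) + k * j                 ≡⟨ cong (λ t → size + (t + y / j * j) + k * j) c+d≡ ⟩
      size + (size * size + suc (y % j) + y / j * j) + k * j
        ≡⟨ cong (λ t → size + t + k * j) (regroup₂ (size * size) (y / j * j) (y % j)) ⟨
      size + (size * size + suc (y % j + y / j * j)) + k * j
        ≡⟨ cong (λ t → size + (size * size + suc t) + k * j) (m≡m%n+[m/n]*n y j) ⟨
      size + (size * size + suc y) + k * j               ≡⟨ cong₂ _+_ total (sym e+b≡) ⟩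
      a + (j + z) + (e + b)                              ≡⟨ regroup₃ a e b j z ⟩
      a + e + (j + (b + z))                              ≡⟨ cong₂ (λ s t → s + (j + t)) a+e≡size b+z≡ ⟩
      size + (j + (c + k′ * j))                          ≡⟨ regroup₄ size j c k′ ⟩
      size + c + suc k′ * j                              ∎
    j∣d : j ∣ d
    j∣d = ∣m+n∣m⇒∣n (divides (suc k′) (+-cancelˡ-≡ (size + c) _ _ balance))
            (subst (j ∣_) (*-distribʳ-+ j (y / j) k) (n∣m*n (y / j + k)))

-- Walks in a Chrobak normal form.

module ChrobakPaths {B : UnaryNFA} (nf : ChrobakNormalForm B) where
  open UnaryNFA B
  open Paths B
  open ChrobakNormalForm nf

  -- The only choice is that of the cycle at time `suc m`; apart from it, the time determines the
  -- state.
  data Position : ℕ → State → Set where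
    on-stem  : ∀ l → Position (toℕ l) (q l)
    on-cycle : ∀ i y → Position (suc m + y) (p i (y mod j i))

  reposition : ∀ {x y s} → x ≡ y → Position x s → Position y s
  reposition refl P = P

  mod-suc : ∀ y n .{{_ : NonZero n}} → suc (toℕ (y mod n)) mod n ≡ suc y mod n
  mod-suc y n = toℕ-injective (begin
    toℕ (suc (toℕ (y mod n)) mod n)  ≡⟨ toℕ-mod _ n ⟩
    suc (toℕ (y mod n)) % n          ≡⟨ cong (λ r → suc r % n) (toℕ-mod y n) ⟩
    (1 + y % n) % n                  ≡⟨ %-distribˡ-+ 1 (y % n) n ⟩
    (1 % n + y % n % n) % n          ≡⟨ cong (λ r → (1 % n + r) % n) (m%n%n≡m%n y n) ⟩
    (1 % n + y % n) % n              ≡⟨ %-distribˡ-+ 1 y n ⟨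
    suc y % n                        ≡⟨ toℕ-mod (suc y) n ⟨
    toℕ (suc y mod n)                ∎)
    where open ≡-Reasoning

  position-step : ∀ {x s s′} → Position x s → s′ ∈succ s → Position (suc x) s′
  position-step (on-stem l) e with view l
  ... | ‵inject₁ i with refl ← to (succ-q-inner i _) e =
    reposition (cong suc (sym (toℕ-inject₁ i))) (on-stem (fsuc i))
  ... | ‵fromℕ with i , refl ← to (succ-q-last _) e =
    reposition (cong suc (trans (+-identityʳ m) (sym (toℕ-fromℕ m)))) (on-cycle i 0)
  position-step (on-cycle i y) e with refl ← to (succ-p i (y mod j i) _) e =
    subst₂ Position (cong suc (+-suc m y)) (cong (p i) (sym (mod-suc y (j i)))) (on-cycle i (suc y))

  position-path : ∀ {x y s s′} → Position x s → Path y s s′ → Position (x + y) s′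
  position-path {x} P stay               = reposition (sym (+-identityʳ x)) P
  position-path {x} P (step {y} e π) =
    reposition (sym (+-suc x y)) (position-path (position-step P e) π)

  path⇒position : ∀ {x s} → Path x initial s → Position x s
  path⇒position = position-path (subst (Position 0) q-initial (on-stem fzero))

  path-stem : ∀ l → Path (toℕ l) initial (q l)
  path-stem = <-weakInduction (λ l → Path (toℕ l) initial (q l))
    (subst (Path 0 initial) (sym q-initial) stay)
    (λ i π → relength (cong suc (toℕ-inject₁ i))
               (snoc π (from (succ-q-inner i _) refl)))

  path-cycle : ∀ i y → Path (suc m + y) initial (p i (y mod j i))
  path-cycle i zero    = relength (cong suc (trans (toℕ-fromℕ m) (sym (+-identityʳ m))))
                           (snoc (path-stem (fromℕ m)) (from (succ-q-last _) (i , refl)))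
  path-cycle i (suc y) = relength (cong suc (sym (+-suc m y)))
                           (snoc (path-cycle i y)
                             (from (succ-p i (y mod j i) _) (cong (p i) (sym (mod-suc y (j i))))))

-- Descending loops that build lists.

-- Counterpart of `foldᵗ` along a numeral. The largest index comes first, so repeated prepending
-- yields ascending order.
forDown : {A : Set} → (ℕ → A → A) → ℕ → A → A
forDown f zero    a = a
forDown f (suc i) a = forDown f i (f i a)

module _ {A : Set} {f : ℕ → List A → List A} {x : A} {P : ℕ → Set}
         (∈f⇔ : ∀ i xs → x ∈ f i xs ⇔ (P i ⊎ x ∈ xs)) where

  ∈-forDown⁻ : ∀ k {xs} → x ∈ forDown f k xs → (∃[ i ] (i < k × P i)) ⊎ x ∈ xs
  ∈-forDown⁻ zero    x∈ = inj₂ x∈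
  ∈-forDown⁻ (suc k) x∈ with ∈-forDown⁻ k x∈
  ... | inj₁ (i , i<k , Pi) = inj₁ (i , m<n⇒m<1+n i<k , Pi)
  ... | inj₂ x∈f with to (∈f⇔ k _) x∈f
  ... | inj₁ Pk  = inj₁ (k , n<1+n k , Pk)
  ... | inj₂ x∈′ = inj₂ x∈′

  ∈-forDown⁺ : ∀ k {xs} → (∃[ i ] (i < k × P i)) ⊎ x ∈ xs → x ∈ forDown f k xs
  ∈-forDown⁺ zero    (inj₂ x∈) = x∈
  ∈-forDown⁺ (suc k) (inj₂ x∈) = ∈-forDown⁺ k (inj₂ (from (∈f⇔ k _) (inj₂ x∈)))
  ∈-forDown⁺ (suc k) (inj₁ (i , s≤s i≤k , Pi)) with m≤n⇒m<n∨m≡n i≤k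
  ... | inj₁ i<k  = ∈-forDown⁺ k (inj₁ (i , i<k , Pi))
  ... | inj₂ refl = ∈-forDown⁺ k (inj₂ (from (∈f⇔ k _) (inj₁ Pi)))

  -- The equivalence has the form of the hypothesis `∈f⇔`, so an inner loop can serve as the round
  -- of an outer one.
  ∈-forDown : ∀ k xs → x ∈ forDown f k xs ⇔ ((∃[ i ] (i < k × P i)) ⊎ x ∈ xs)
  ∈-forDown k xs = mk⇔ (∈-forDown⁻ k) (∈-forDown⁺ k)

∈-∷ : {A : Set} {x y : A} (xs : List A) → x ∈ y ∷ xs ⇔ (x ≡ y ⊎ x ∈ xs)
∈-∷ xs = mk⇔ (λ { (here eq) → inj₁ eq ; (there x∈) → inj₂ x∈ }) [ here , there ]′

∈-cond-∷ : {A : Set} {x y : A} (t : Tree) (xs : List A) →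
           x ∈ cond t (y ∷ xs) xs ⇔ ((t ≢ nil × x ≡ y) ⊎ x ∈ xs)
∈-cond-∷ nil        xs = mk⇔ inj₂ [ (λ (nil≢nil , _) → contradiction refl nil≢nil) , (λ x∈ → x∈) ]′
∈-cond-∷ (cons _ _) xs = mk⇔ (λ { (here eq) → inj₁ ((λ ()) , eq) ; (there x∈) → inj₂ x∈ })
                             [ here ∘ proj₂ , there ]′

-- The automaton in normal form.

-- `k` plus the triangular number `1 + … + i`, which is the total length of the cycles before cycle
-- `i`.
offset : ℕ → ℕ → ℕ
offset k zero    = k
offset k (suc i) = suc i + offset k i

-- With stem 0, …, m, the cycle with index i has length suc i and consists of
-- the states off i, …, off i + i; off n is the number of all states.
module Construction (n m : ℕ) (short : ℕ → Tree) (periodic : ℕ → ℕ → Tree) where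

  off : ℕ → ℕ
  off = offset (suc m)

  node : ℕ → ℕ → ℕ
  node i h = h + off i

  off-nonZero : ∀ i → NonZero (off i)
  off-nonZero zero    = _
  off-nonZero (suc i) = _

  instance
    off-n-nonZero : NonZero (off n)
    off-n-nonZero = off-nonZero n

  St : Set
  St = Fin (off n)

  -- Reduction modulo the number of states makes the numbering total, so that transitions can be
  -- listed without bounds at hand. On numbers with a `Name` it changes nothing.
  st : ℕ → St
  st x = x mod off n

  data Edge : ℕ → ℕ → Set where
    chain : ∀ {x} → x < m → Edge x (suc x)
    enter : ∀ {i} → i < n → Edge m (node i 0)
    wrap  : ∀ {i} → i < n → Edge (node i i) (node i 0)
    along : ∀ {i h} → i < n → h < i → Edge (node i h) (node i (suc h))

  chainStep : ℕ → List (St × St) → List (St × St)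
  chainStep x ts = (st x , st (suc x)) ∷ ts

  alongStep : ℕ → ℕ → List (St × St) → List (St × St)
  alongStep i h ts = (st (node i h) , st (node i (suc h))) ∷ ts

  cycleSteps : ℕ → List (St × St) → List (St × St)
  cycleSteps i ts = (st m , st (node i 0)) ∷ (st (node i i) , st (node i 0)) ∷ forDown (alongStep i) i ts

  stemFinal : ℕ → List St → List St
  stemFinal x xs = cond (short x) (st x ∷ xs) xs

  nodeFinal : ℕ → ℕ → List St → List St
  nodeFinal i h xs = cond (periodic i h) (st (node i h) ∷ xs) xs

  automaton : UnaryNFA
  automaton = record
    { size        = off n
    ; initial     = st 0
    ; transitions = forDown chainStep m (forDown cycleSteps n [])
    ; final       = forDown stemFinal (suc m) (forDown (λ i → forDown (nodeFinal i) (suc i)) n [])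
    }
  open UnaryNFA automaton

  suc-m≤off : ∀ i → suc m ≤ off i
  suc-m≤off zero    = ≤-refl
  suc-m≤off (suc i) = ≤-trans (suc-m≤off i) (m≤n+m (off i) (suc i))

  off-mono : ∀ {i i′} → i ≤ i′ → off i ≤ off i′
  off-mono {i′ = zero}   z≤n = ≤-refl
  off-mono {i′ = suc i′} i≤ with m≤n⇒m<n∨m≡n i≤
  ... | inj₁ (s≤s i≤i′) = ≤-trans (off-mono i≤i′) (m≤n+m (off i′) (suc i′))
  ... | inj₂ refl       = ≤-refl

  node< : ∀ {i i′ h} → i < i′ → h ≤ i → node i h < off i′
  node< {i} i<i′ h≤i = ≤-trans (+-monoˡ-≤ (off i) (s≤s h≤i)) (off-mono i<i′)

  stem<node : ∀ {x} i h → x ≤ m → x < node i h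
  stem<node i h x≤m = ≤-trans (s≤s x≤m) (≤-trans (suc-m≤off i) (m≤n+m (off i) h))

  node-injective : ∀ {i h i′ h′} → h ≤ i → h′ ≤ i′ → node i h ≡ node i′ h′ → i ≡ i′ × h ≡ h′
  node-injective {i} {h} {i′} {h′} h≤i h′≤i′ eq with <-cmp i i′
  ... | tri< i<i′ _ _ = contradiction eq (<⇒≢ (<-≤-trans (node< i<i′ h≤i) (m≤n+m (off i′) h′)))
  ... | tri≈ _ refl _ = refl , +-cancelʳ-≡ (off i) h h′ eq
  ... | tri> _ _ i′<i = contradiction (sym eq) (<⇒≢ (<-≤-trans (node< i′<i h′≤i′) (m≤n+m (off i) h)))

  data Name : ℕ → Set where
    stem  : ∀ {x} → x ≤ m → Name x
    cycle : ∀ {i h} → i < n → h ≤ i → Name (node i h)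

  -- Descent from the last cycle: a number below `off (suc i)` lies on cycle `i` unless it is below
  -- `off i`, and `off 0` bounds the stem.
  name : ∀ {x} → x < off n → Name x
  name = go n ≤-refl
    where
    go : ∀ i {x} → i ≤ n → x < off i → Name x
    go zero    _   (s≤s x≤m) = stem x≤m
    go (suc i) {x} i<n x<off with x <? off i
    ... | yes x<offᵢ = go i (<⇒≤ i<n) x<offᵢ
    ... | no  x≮offᵢ with x ∸ off i | m∸n+n≡m (≮⇒≥ x≮offᵢ)
    ... | h | refl =
      cycle i<n (s≤s⁻¹ (+-cancelʳ-< (off i) h (suc i) x<off))

  name-< : ∀ {x} → Name x → x < off n
  name-< (stem x≤m)     = ≤-trans (s≤s x≤m) (suc-m≤off n)
  name-< (cycle i<n h≤) = node< i<n h≤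

  toℕ-st : ∀ {x} → Name x → toℕ (st x) ≡ x
  toℕ-st {x} N = trans (toℕ-mod x (off n)) (m<n⇒m%n≡m (name-< N))

  st-injective : ∀ {x y} → Name x → Name y → st x ≡ st y → x ≡ y
  st-injective M N eq = trans (sym (toℕ-st M)) (trans (cong toℕ eq) (toℕ-st N))

  st-toℕ : ∀ (s : St) → st (toℕ s) ≡ s
  st-toℕ s = toℕ-injective (toℕ-st (name (toℕ<n s)))

  edge-source : ∀ {x y} → Edge x y → Name x
  edge-source (chain x<m)     = stem (<⇒≤ x<m)
  edge-source (enter _)       = stem ≤-refl
  edge-source (wrap i<n)      = cycle i<n ≤-refl
  edge-source (along i<n h<i) = cycle i<n (<⇒≤ h<i)

  IsEdge : St × St → Set
  IsEdge t = ∃[ x ] ∃[ y ] (Edge x y × t ≡ (st x , st y))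

  ∈-cycleSteps : ∀ {t} i ts → t ∈ cycleSteps i ts ⇔
    ((t ≡ (st m , st (node i 0)) ⊎ t ≡ (st (node i i) , st (node i 0)) ⊎
      ∃[ h ] (h < i × t ≡ (st (node i h) , st (node i (suc h))))) ⊎ t ∈ ts)
  ∈-cycleSteps i ts = mk⇔
    (λ { (here eq)          → inj₁ (inj₁ eq)
       ; (there (here eq))  → inj₁ (inj₂ (inj₁ eq))
       ; (there (there t∈)) → [ inj₁ ∘ inj₂ ∘ inj₂ , inj₂ ]′ (∈-forDown⁻ (λ _ → ∈-∷) i t∈) })
    (λ { (inj₁ (inj₁ eq))        → here eq
       ; (inj₁ (inj₂ (inj₁ eq))) → there (here eq)
       ; (inj₁ (inj₂ (inj₂ h)))  → there (there (∈-forDown⁺ (λ _ → ∈-∷) i (inj₁ h)))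
       ; (inj₂ t∈)               → there (there (∈-forDown⁺ (λ _ → ∈-∷) i (inj₂ t∈))) })

  ∈transitions⁻ : ∀ {t} → t ∈ transitions → IsEdge t
  ∈transitions⁻ t∈ with ∈-forDown⁻ (λ _ → ∈-∷) m t∈
  ... | inj₁ (x , x<m , refl) = _ , _ , chain x<m , refl
  ... | inj₂ t∈′ with ∈-forDown⁻ ∈-cycleSteps n t∈′
  ... | inj₁ (i , i<n , inj₁ refl)                    = _ , _ , enter i<n , refl
  ... | inj₁ (i , i<n , inj₂ (inj₁ refl))             = _ , _ , wrap i<n , refl
  ... | inj₁ (i , i<n , inj₂ (inj₂ (h , h<i , refl))) = _ , _ , along i<n h<i , refl

  edge∈transitions : ∀ {x y} → Edge x y → (st x , st y) ∈ transitions
  edge∈transitions {x} (chain x<m) = ∈-forDown⁺ (λ _ → ∈-∷) m (inj₁ (x , x<m , refl))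
  edge∈transitions (enter {i} i<n) = ∈-forDown⁺ (λ _ → ∈-∷) m (inj₂
    (∈-forDown⁺ ∈-cycleSteps n (inj₁ (i , i<n , inj₁ refl))))
  edge∈transitions (wrap {i} i<n) = ∈-forDown⁺ (λ _ → ∈-∷) m (inj₂
    (∈-forDown⁺ ∈-cycleSteps n (inj₁ (i , i<n , inj₂ (inj₁ refl)))))
  edge∈transitions (along {i} {h} i<n h<i) = ∈-forDown⁺ (λ _ → ∈-∷) m (inj₂
    (∈-forDown⁺ ∈-cycleSteps n (inj₁ (i , i<n , inj₂ (inj₂ (h , h<i , refl))))))

  -- Injectivity of `st` on names recovers the number of the source, after which successors are
  -- found by cases on `Edge`.
  succ-edge : ∀ {x s} → Name x → s ∈succ st x → ∃[ y ] (Edge x y × s ≡ st y)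
  succ-edge N e with x , y , E , eq ← ∈transitions⁻ e
    with refl ← st-injective N (edge-source E) (cong proj₁ eq)
    = y , E , cong proj₂ eq

  from-inner : ∀ {x y} → x < m → Edge x y → y ≡ suc x
  from-inner x<m (chain _)         = refl
  from-inner x<m (enter _)         = contradiction x<m (<-irrefl refl)
  from-inner x<m (wrap {i} _)      = contradiction x<m (<⇒≯ (stem<node i i ≤-refl))
  from-inner x<m (along {i} {h} _ _) = contradiction x<m (<⇒≯ (stem<node i h ≤-refl))

  from-last : ∀ {x y} → x ≡ m → Edge x y → ∃[ i ] (i < n × y ≡ node i 0)
  from-last x≡m (chain x<m)         = contradiction x≡m (<⇒≢ x<m)
  from-last x≡m (enter i<n)         = _ , i<n , refl
  from-last x≡m (wrap {i} _)        = contradiction (sym x≡m) (<⇒≢ (stem<node i i ≤-refl))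
  from-last x≡m (along {i} {h} _ _) = contradiction (sym x≡m) (<⇒≢ (stem<node i h ≤-refl))

  -- The source is given by an equation because `node i h` is a sum and does not unify with the sums
  -- in `Edge`; `node-injective` resolves it instead.
  from-node : ∀ {i h x y} → h ≤ i → x ≡ node i h → Edge x y → y ≡ node i (suc h % suc i)
  from-node {i} {h} h≤i x≡ (chain x<m) = contradiction x≡ (<⇒≢ (stem<node i h (<⇒≤ x<m)))
  from-node {i} {h} h≤i x≡ (enter _)   = contradiction x≡ (<⇒≢ (stem<node i h ≤-refl))
  from-node {i} {h} h≤i x≡ (wrap {i′} _) with refl , refl ← node-injective {i′} {i′} {i} {h} ≤-refl h≤i x≡ =
    cong (node i) (sym (n%n≡0 (suc i)))
  from-node {i} {h} h≤i x≡ (along {i′} {h′} _ h<i) with refl , refl ← node-injective {i′} {h′} {i} {h} (<⇒≤ h<i) h≤i x≡ =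
    cong (node i) (sym (m<n⇒m%n≡m (s≤s h<i)))

  node-edge : ∀ {i h} → i < n → h ≤ i → Edge (node i h) (node i (suc h % suc i))
  node-edge {i} {h} i<n h≤i with m≤n⇒m<n∨m≡n h≤i
  ... | inj₁ h<i  = subst (λ r → Edge (node i h) (node i r)) (sym (m<n⇒m%n≡m (s≤s h<i))) (along i<n h<i)
  ... | inj₂ refl = subst (λ r → Edge (node i h) (node i r)) (sym (n%n≡0 (suc i))) (wrap i<n)

  stemName : ∀ (l : Fin (suc m)) → Name (toℕ l)
  stemName l = stem (s≤s⁻¹ (toℕ<n l))

  stemState : Fin (suc m) → St
  stemState l = st (toℕ l)

  nodeName : ∀ (i : Fin n) (h : Fin (suc (toℕ i))) → Name (node (toℕ i) (toℕ h))
  nodeName i h = cycle (toℕ<n i) (s≤s⁻¹ (toℕ<n h))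

  nodeState : (i : Fin n) → Fin (suc (toℕ i)) → St
  nodeState i h = st (node (toℕ i) (toℕ h))

  stemState-fromℕ : stemState (fromℕ m) ≡ st m
  stemState-fromℕ = cong st (toℕ-fromℕ m)

  fromℕ<-edge : ∀ {i} (i<n : i < n) → st (node i 0) ≡ nodeState (fromℕ< i<n) (0 mod suc (toℕ (fromℕ< i<n)))
  fromℕ<-edge i<n = cong (λ i → st (node i 0)) (sym (toℕ-fromℕ< i<n))

  named : ∀ {x} → Name x → (∃[ l ] st x ≡ stemState l) ⊎ (∃[ i ] ∃[ h ] st x ≡ nodeState i h)
  named (stem x≤m)            = inj₁ (fromℕ< (s≤s x≤m) , cong st (sym (toℕ-fromℕ< (s≤s x≤m))))
  named (cycle {i} {h} i<n h≤i) = inj₂ (fromℕ< i<n , fromℕ< h< , cong st (cong₂ node (sym i≡) (sym (toℕ-fromℕ< h<))))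
    where
    i≡ = toℕ-fromℕ< i<n
    h< : h < suc (toℕ (fromℕ< i<n))
    h< = subst (λ i → h < suc i) (sym i≡) (s≤s h≤i)

  node-mod : ∀ (i : Fin n) h → st (node (toℕ i) (h % suc (toℕ i))) ≡ nodeState i (h mod suc (toℕ i))
  node-mod i h = cong (st ∘ node (toℕ i)) (sym (toℕ-mod h (suc (toℕ i))))

  chrobak : ChrobakNormalForm automaton
  chrobak = record
    { m = m
    ; k = n
    ; j = λ i → suc (toℕ i)
    ; q = stemState
    ; p = nodeState
    ; q-initial = refl
    ; cover = λ s → subst (λ s → (∃[ l ] s ≡ stemState l) ⊎ (∃[ i ] ∃[ h ] s ≡ nodeState i h)) (st-toℕ s)
                      (named (name (toℕ<n s)))
    ; q-injective = λ {l} {l′} eq → toℕ-injective (st-injective (stemName l) (stemName l′) eq)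
    ; p-injective = λ i {h} {h′} eq →
        toℕ-injective (+-cancelʳ-≡ (off (toℕ i)) _ _ (st-injective (nodeName i h) (nodeName i h′) eq))
    ; q-p-disjoint = λ l i h eq →
        <⇒≢ (stem<node (toℕ i) (toℕ h) (s≤s⁻¹ (toℕ<n l))) (st-injective (stemName l) (nodeName i h) eq)
    ; p-p-disjoint = λ {i} {i′} i≢i′ h h′ eq →
        i≢i′ (toℕ-injective (proj₁ (node-injective (s≤s⁻¹ (toℕ<n h)) (s≤s⁻¹ (toℕ<n h′))
          (st-injective (nodeName i h) (nodeName i′ h′) eq))))
    ; succ-q-inner = λ i s → mk⇔
        (λ e → let y , E , s≡ = succ-edge (stemName (inject₁ i)) e in
          trans s≡ (cong st (trans (from-inner (i<m i) E) (cong suc (toℕ-inject₁ i)))))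
        (λ { refl → subst (λ x → (stemState (inject₁ i) , st (suc x)) ∈ transitions) (toℕ-inject₁ i)
                      (edge∈transitions (chain (i<m i))) })
    ; succ-q-last = λ s → mk⇔
        (λ e → let y , E , s≡ = succ-edge (stemName (fromℕ m)) e
                   i , i<n , y≡ = from-last (toℕ-fromℕ m) E in
          fromℕ< i<n , trans s≡ (trans (cong st y≡) (fromℕ<-edge i<n)))
        (λ { (i , refl) → subst (λ x → (x , st (node (toℕ i) 0)) ∈ transitions) (sym stemState-fromℕ)
                            (edge∈transitions (enter (toℕ<n i))) })
    ; succ-p = λ i h s → mk⇔
        (λ e → let y , E , s≡ = succ-edge (nodeName i h) e in
          trans s≡ (trans (cong st (from-node (s≤s⁻¹ (toℕ<n h)) refl E)) (node-mod i (suc (toℕ h)))))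
        (λ { refl → subst (λ s → (nodeState i h , s) ∈ transitions) (node-mod i (suc (toℕ h)))
                      (edge∈transitions (node-edge (toℕ<n i) (s≤s⁻¹ (toℕ<n h)))) })
    }
    where
    i<m : ∀ (i : Fin m) → toℕ (inject₁ i) < m
    i<m i = subst (_< m) (sym (toℕ-inject₁ i)) (toℕ<n i)

  ∈final⁻ : ∀ {s} → s ∈ final →
    (∃[ x ] (x < suc m × short x ≢ nil × s ≡ st x)) ⊎
    (∃[ i ] (i < n × ∃[ h ] (h < suc i × periodic i h ≢ nil × s ≡ st (node i h))))
  ∈final⁻ s∈ with ∈-forDown⁻ (λ x → ∈-cond-∷ (short x)) (suc m) s∈
  ... | inj₁ stemFinal = inj₁ stemFinal
  ... | inj₂ s∈′ with ∈-forDown⁻ (λ i → ∈-forDown (λ h → ∈-cond-∷ (periodic i h)) (suc i)) n s∈′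
  ... | inj₁ nodeFinal = inj₂ nodeFinal

  stem∈final : ∀ {x} → x ≤ m → short x ≢ nil → st x ∈ final
  stem∈final x≤m accepted =
    ∈-forDown⁺ (λ x → ∈-cond-∷ (short x)) (suc m) (inj₁ (_ , s≤s x≤m , accepted , refl))

  node∈final : ∀ {i h} → i < n → h ≤ i → periodic i h ≢ nil → st (node i h) ∈ final
  node∈final i<n h≤i accepted =
    ∈-forDown⁺ (λ x → ∈-cond-∷ (short x)) (suc m) (inj₂
      (∈-forDown⁺ (λ i → ∈-forDown (λ h → ∈-cond-∷ (periodic i h)) (suc i)) n
        (inj₁ (_ , i<n , _ , s≤s h≤i , accepted , refl))))

  open ChrobakPaths chrobak

  data Language : ℕ → Set where
    below : ∀ {x} → x ≤ m → short x ≢ nil → Language x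
    above : ∀ (i : Fin n) y → periodic (toℕ i) (y % suc (toℕ i)) ≢ nil → Language (suc m + y)

  -- The position of the path and the origin of the final state name the same state. Injectivity of
  -- the numbering makes them agree and rules out the mixed cases.
  accepts⇒language : ∀ {x} → Accepts x → Language x
  accepts⇒language (s , s∈final , π) with path⇒position π | ∈final⁻ s∈final
  ... | on-stem l | inj₁ (x , s≤s x≤m , accepted , eq) with refl ← st-injective (stemName l) (stem x≤m) eq =
    below x≤m accepted
  ... | on-stem l | inj₂ (i , i<n , h , s≤s h≤i , accepted , eq) =
    contradiction (st-injective (stemName l) (cycle i<n h≤i) eq) (<⇒≢ (stem<node i h (s≤s⁻¹ (toℕ<n l))))
  ... | on-cycle i y | inj₁ (x , s≤s x≤m , accepted , eq) =
    contradiction (st-injective (stem x≤m) (nodeName i _) (sym eq)) (<⇒≢ (stem<node (toℕ i) _ x≤m))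
  ... | on-cycle i y | inj₂ (i′ , i<n , h , s≤s h≤i , accepted , eq)
    with refl , refl ← node-injective (s≤s⁻¹ (toℕ<n (y mod suc (toℕ i)))) h≤i
                         (st-injective (nodeName i _) (cycle i<n h≤i) eq) =
    above i y (subst (λ h → periodic (toℕ i) h ≢ nil) (toℕ-mod y (suc (toℕ i))) accepted)

  language⇒accepts : ∀ {x} → Language x → Accepts x
  language⇒accepts (below {x} x≤m accepted) =
    st x , stem∈final x≤m accepted ,
    subst (λ y → Path y initial (st y)) (toℕ-fromℕ< (s≤s x≤m)) (path-stem (fromℕ< (s≤s x≤m)))
  language⇒accepts (above i y accepted) =
    st (node (toℕ i) (y % suc (toℕ i))) , node∈final (toℕ<n i) (s≤s⁻¹ (m%n<n y (suc (toℕ i)))) accepted ,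
    subst (Path (suc m + y) initial) (sym (node-mod i y)) (path-cycle i y)

-- Equivalence with the given automaton.

module _ (A : UnaryNFA) (short : ℕ → Tree) (periodic : ℕ → ℕ → Tree) where
  open UnaryNFA A using (size; Accepts)
  open Paths A using (AcceptsThroughCycle; throughCycle-sound; throughCycle-complete)
  open Construction size (size + size * size) short periodic

  -- For `h ≤ i`, cycle `i` is first at its index `h` at time `suc m + h`, which is
  -- `n + (n² + suc h)`; hence the successor in the second hypothesis.
  equivalent : (∀ x → short x ≢ nil ⇔ Accepts x) →
               (∀ i h → periodic i h ≢ nil ⇔ AcceptsThroughCycle size (suc i) (size * size + suc h)) →
               Equivalent A automaton
  equivalent short⇔ periodic⇔ x = mk⇔ (language⇒accepts ∘ accepts⇒) (⇐accepts ∘ accepts⇒language)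
    where
    m : ℕ
    m = size + size * size
    regroup : ∀ y → suc m + y ≡ size + (size * size + suc y)
    regroup y = trans (sym (+-suc m y)) (+-assoc size (size * size) (suc y))
    accepts⇒ : ∀ {x} → Accepts x → Language x
    accepts⇒ {x} a with x ≤? m
    ... | yes x≤m = below x≤m (from (short⇔ x) a)
    ... | no  x≰m with y , refl ← m≤n⇒∃[o]m+o≡n (≰⇒> x≰m) =
      let i , t = throughCycle-complete y (subst Accepts (regroup y) a)
      in above i y (from (periodic⇔ (toℕ i) (y % suc (toℕ i))) t)
    ⇐accepts : ∀ {x} → Language x → Accepts x
    ⇐accepts (below {x} x≤m a) = to (short⇔ x) a
    ⇐accepts (above i y a)     = subst Accepts (sym (regroup y))
      (throughCycle-sound y (to (periodic⇔ (toℕ i) (y % suc (toℕ i))) a))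

-- The algorithm as terms.

add : ∀ {r w} → View r → Term r w → Term r w
add v t = fold v t (cons nil (var 0F))

nth : ∀ {r w} → View r → Term r w → Term r w
nth v t = hd (fold v t (tl (var 0F)))

-- Two numbers agree when both truncated differences vanish; each is obtained by dropping as many
-- entries from one list as the other has.
equal : ∀ {r w} → View r → View r → Term r w
equal u v = if fold u (read v) (tl (var 0F)) then nil else
            (if fold v (read u) (tl (var 0F)) then nil else cons nil nil)

countᵛ squareᵛ stemᵛ totalᵛ transitionsᵛ initialᵛ finalᵛ : ∀ {r} → View r → View r
countᵛ       g = hd g
squareᵛ      g = hd (tl g)
stemᵛ        g = hd (tl (tl g))
totalᵛ       g = hd (tl (tl (tl g)))
transitionsᵛ g = hd (tl (tl (tl (tl g))))
initialᵛ     g = hd (tl (tl (tl (tl (tl g)))))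
finalᵛ       g = tl (tl (tl (tl (tl (tl g)))))

-- Computes the read-only tree g of all later terms: n, n², m + 1 and the number
-- of states of the normal form, then the input without its list of states.
-- These numbers are what the later loops run along.
preprocess : Term 1 0
preprocess =
  cons (add states nil)
    (cons square
      (cons stem
        -- The successive rests of the list of states have lengths `n`, ..., `1`; together they
        -- count all cycle states.
        (cons (fold states stem (add (var 0F) (var 0F)))
          (read (tl (var 0F))))))
  where
  states = hd (var 0F)
  square = fold states nil (add (hd (var 1F)) (var 0F))
  stem   = cons nil (add states square)

-- A set of states is the list of the truth values of its characteristic
-- function.
advance : Term 1 1
advance = fold (countᵛ (var 0F)) nil
  (cons (fold (transitionsᵛ (var 1F)) nil
          (if var 0F then var 0F else
            -- The working variable `var 2F` is the given set, below the accumulators of both loops.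
            (if equal (tl (hd (var 0F))) (tl (var 1F)) then nth (hd (hd (var 0F))) (var 2F) else nil)))
        (var 0F))

iterate : Term 2 1
iterate = fold (var 0F) (var 0F) (call advance (var 2F ∷ []) (var 0F))

singleton : Term 2 1
singleton = fold (countᵛ (var 1F)) nil (cons (equal (var 1F) (tl (var 0F))) (var 0F))

-- Each state is tested from its own singleton: iterating on the whole set would not show which
-- state returns to itself.
restrictToCycle : Term 2 1
restrictToCycle = fold (countᵛ (var 1F)) nil
  (cons (if nth (tl (var 0F)) (var 1F)
         then nth (tl (var 0F)) (call iterate (var 1F ∷ var 2F ∷ [])
                                  (call singleton (tl (var 0F) ∷ var 2F ∷ []) nil))
         else nil)
        (var 0F))

meetsFinal : Term 1 1
meetsFinal = fold (finalᵛ (var 0F)) nil (if var 0F then var 0F else nth (hd (var 0F)) (var 1F))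

start : ∀ {r w} → View r → Term r w
start g = call singleton (initialᵛ g ∷ g ∷ []) nil

shortTest : Term 2 1
shortTest = call meetsFinal (g ∷ []) (call iterate (var 0F ∷ g ∷ []) (start g))
  where g = var 1F

-- Read from the inside: `n` steps, restriction to states with a closed walk of length `i + 1`, `n²`
-- steps, `h + 1` steps. The last two are separate because their sum would be a working tree, along
-- which no loop can run.
periodicTest : Term 3 1
periodicTest =
  call meetsFinal (g ∷ [])
    (call iterate (var 0F ∷ g ∷ [])
      (call iterate (squareᵛ g ∷ g ∷ [])
        (call restrictToCycle (var 1F ∷ g ∷ [])
          (call iterate (countᵛ g ∷ g ∷ []) (start g)))))
  where g = var 2F

-- `j` holds `i + 1`, so the loop along its tail adds `i`, ..., `1`, the triangular number in
-- `off i`.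
offsetTerm : ∀ {r w} → View r → View r → Term r w
offsetTerm j g = fold (tl j) (read (stemᵛ g)) (add (var 0F) (var 0F))

statesTerm : Term 1 0
statesTerm = fold (totalᵛ (var 0F)) nil (cons (read (tl (var 0F))) (var 0F))

-- Mirrors `cycleSteps i` entry by entry. Loop variables exceed the index by one, whence
-- `tl (var 0F)` for `i` and, in the inner loop, for `h`.
cycleTerm : Term 2 1
cycleTerm =
  cons (cons (read (tl (stemᵛ (var 1F)))) (offsetTerm (var 0F) (var 1F)))
    (cons (cons (add (tl (var 0F)) (offsetTerm (var 0F) (var 1F))) (offsetTerm (var 0F) (var 1F)))
      (fold (tl (var 0F)) (var 0F)
        (cons (cons (add (tl (var 0F)) (offsetTerm (var 1F) (var 2F)))
                    (add (var 0F) (offsetTerm (var 1F) (var 2F))))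
              (var 0F))))

transitionsTerm : Term 1 0
transitionsTerm =
  fold (tl (stemᵛ (var 0F))) (fold (countᵛ (var 0F)) nil cycleTerm)
    (cons (cons (read (tl (var 0F))) (read (var 0F))) (var 0F))

finalTerm : Term 1 0
finalTerm =
  fold (stemᵛ (var 0F))
    (fold (countᵛ (var 0F)) nil
      (fold (var 0F) (var 0F)
        (if call periodicTest (var 0F ∷ var 1F ∷ var 2F ∷ []) nil
         then cons (add (tl (var 0F)) (offsetTerm (var 1F) (var 2F))) (var 0F)
         else var 0F)))
    (if call shortTest (tl (var 0F) ∷ var 1F ∷ []) nil
     then cons (read (tl (var 0F))) (var 0F)
     else var 0F)

output : Term 1 0
-- The `nil` is the numeral of the initial state 0.
output = cons statesTerm (cons transitionsTerm (cons nil finalTerm))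

-- Values of the terms on encoded numbers and lists.

addᵗ dropᵗ : Tree → Tree → Tree
addᵗ  = foldᵗ (λ _ → cons nil)
dropᵗ = foldᵗ (λ _ → tail)

nthᵗ : Tree → Tree → Tree
nthᵗ u t = head (dropᵗ u t)

-- The number of rounds of a loop along the tree. It lets the list of states play the part of the
-- numeral `n`.
spine : Tree → ℕ
spine nil        = 0
spine (cons _ t) = suc (spine t)

spine-encodeℕ : ∀ k → spine (encodeℕ k) ≡ k
spine-encodeℕ zero    = refl
spine-encodeℕ (suc k) = cong suc (spine-encodeℕ k)

spine-encodeList : ∀ ts → spine (encodeList ts) ≡ List.length ts
spine-encodeList []       = refl
spine-encodeList (t ∷ ts) = cong suc (spine-encodeList ts)

add-correct : ∀ u k → addᵗ u (encodeℕ k) ≡ encodeℕ (spine u + k)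
add-correct nil        k = refl
add-correct (cons t u) k = trans (add-correct u (suc k)) (cong encodeℕ (+-suc (spine u) k))

product-correct : ∀ u v k → foldᵗ (λ _ → addᵗ v) u (encodeℕ k) ≡ encodeℕ (spine u * spine v + k)
product-correct nil        v k = refl
product-correct (cons t u) v k = begin
  foldᵗ (λ _ → addᵗ v) u (addᵗ v (encodeℕ k))               ≡⟨ cong (foldᵗ _ u) (add-correct v k) ⟩
  foldᵗ (λ _ → addᵗ v) u (encodeℕ (spine v + k))            ≡⟨ product-correct u v (spine v + k) ⟩
  encodeℕ (spine u * spine v + (spine v + k))
    ≡⟨ cong encodeℕ (regroup (spine u * spine v) (spine v) k) ⟩
  encodeℕ (spine v + spine u * spine v + k)                 ∎
  where
  open ≡-Reasoning
  regroup : ∀ a b c → a + (b + c) ≡ b + a + c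
  regroup = solve-∀

offset-+ : ∀ j k i → offset (j + k) i ≡ j + offset k i
offset-+ j k zero    = refl
offset-+ j k (suc i) = trans (cong (suc i +_) (offset-+ j k i)) (swap (suc i) j (offset k i))
  where
  swap : ∀ a b c → a + (b + c) ≡ b + (a + c)
  swap = solve-∀

offset-correct : ∀ u k → foldᵗ addᵗ u (encodeℕ k) ≡ encodeℕ (offset k (spine u))
offset-correct nil          k = refl
offset-correct v@(cons t u) k = begin
  foldᵗ addᵗ u (addᵗ v (encodeℕ k))          ≡⟨ cong (foldᵗ addᵗ u) (add-correct v k) ⟩
  foldᵗ addᵗ u (encodeℕ (spine v + k))       ≡⟨ offset-correct u (spine v + k) ⟩
  encodeℕ (offset (spine v + k) (spine u))   ≡⟨ cong encodeℕ (offset-+ (spine v) k (spine u)) ⟩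
  encodeℕ (offset k (spine v))               ∎
  where open ≡-Reasoning

offset-≤ : ∀ k i → offset k i ≤ k + i * i
offset-≤ k zero    = m≤m+n k 0
offset-≤ k (suc i) = begin
  suc i + offset k i         ≤⟨ +-monoʳ-≤ (suc i) (offset-≤ k i) ⟩
  suc i + (k + i * i)        ≤⟨ m≤m+n _ i ⟩
  suc i + (k + i * i) + i    ≡⟨ regroup k i ⟩
  k + suc i * suc i          ∎
  where
  open ≤-Reasoning
  regroup : ∀ k i → suc i + (k + i * i) + i ≡ k + suc i * suc i
  regroup = solve-∀

drop-tail : ∀ k t → dropᵗ (encodeℕ k) (tail t) ≡ tail (dropᵗ (encodeℕ k) t)
drop-tail zero    t = refl
drop-tail (suc k) t = drop-tail k (tail t)

drop-encodeℕ : ∀ j k → dropᵗ (encodeℕ j) (encodeℕ k) ≡ encodeℕ (k ∸ j)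
drop-encodeℕ zero    k       = refl
drop-encodeℕ (suc j) zero    = trans (drop-encodeℕ j zero) (cong encodeℕ (0∸n≡0 j))
drop-encodeℕ (suc j) (suc k) = drop-encodeℕ j k

drop-comprehension : ∀ (φ : Tree → Tree) k t → dropᵗ (encodeℕ k) (foldᵗ (λ u → cons (φ u)) (encodeℕ k) t) ≡ t
drop-comprehension φ zero    t = refl
drop-comprehension φ (suc k) t =
  trans (drop-tail k _) (cong tail (drop-comprehension φ k (cons (φ (encodeℕ (suc k))) t)))

-- After the round that prepends `φ (encodeℕ (suc i))`, exactly `i` more entries are prepended, so
-- dropping `i` of them exposes it.
nth-comprehension : ∀ (φ : Tree → Tree) {i} k t → i < k →
  nthᵗ (encodeℕ i) (foldᵗ (λ u → cons (φ u)) (encodeℕ k) t) ≡ φ (encodeℕ (suc i))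
nth-comprehension φ (suc k) t (s≤s i≤k) with m≤n⇒m<n∨m≡n i≤k
... | inj₁ i<k  = nth-comprehension φ k _ i<k
... | inj₂ refl = cong head (drop-comprehension φ k _)

_⟨⇔⟩_ : ∀ {P Q R : Set} → P ⇔ Q → Q ⇔ R → P ⇔ R
P⇔Q ⟨⇔⟩ Q⇔R = mk⇔ (to Q⇔R ∘ to P⇔Q) (from P⇔Q ∘ from Q⇔R)

≡⇒≢nil⇔ : ∀ {t u : Tree} → t ≡ u → t ≢ nil ⇔ u ≢ nil
≡⇒≢nil⇔ refl = mk⇔ id id

and-correct : ∀ t u → cond {Tree} t u nil ≢ nil ⇔ (t ≢ nil × u ≢ nil)
and-correct nil        u = mk⇔ (contradiction refl) (λ (t≢nil , _) → contradiction refl t≢nil)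
and-correct (cons _ _) u = mk⇔ (λ u≢nil → (λ ()) , u≢nil) proj₂

encodeℕ≡nil : ∀ {k} → encodeℕ k ≡ nil → k ≡ 0
encodeℕ≡nil {zero} _ = refl

equalᵗ : Tree → Tree → Tree
equalᵗ u v = cond (dropᵗ u v) nil (cond (dropᵗ v u) nil (cons nil nil))

nor-correct : ∀ t u → cond {Tree} t nil (cond u nil (cons nil nil)) ≢ nil ⇔ (t ≡ nil × u ≡ nil)
nor-correct nil        nil        = mk⇔ (λ _ → refl , refl) (λ _ ())
nor-correct nil        (cons _ _) = mk⇔ (contradiction refl) (λ ())
nor-correct (cons _ _) u          = mk⇔ (contradiction refl) (λ ())

equal-correct : ∀ j k → equalᵗ (encodeℕ j) (encodeℕ k) ≢ nil ⇔ j ≡ k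
equal-correct j k rewrite drop-encodeℕ j k | drop-encodeℕ k j =
  nor-correct (encodeℕ (k ∸ j)) (encodeℕ (j ∸ k)) ⟨⇔⟩
  mk⇔ (λ (k∸j , j∸k) → ≤-antisym (m∸n≡0⇒m≤n (encodeℕ≡nil j∸k)) (m∸n≡0⇒m≤n (encodeℕ≡nil k∸j)))
      (λ { refl → cong encodeℕ (n∸n≡0 j) , cong encodeℕ (n∸n≡0 j) })

or-correct : ∀ a t → cond {Tree} a a t ≢ nil ⇔ (a ≢ nil ⊎ t ≢ nil)
or-correct nil        t = mk⇔ inj₂ [ contradiction refl , id ]′
or-correct (cons _ _) t = mk⇔ inj₁ (λ _ ())

anyᵗ : (Tree → Tree) → Tree → Tree → Tree
anyᵗ φ = foldᵗ (λ u a → cond a a (φ (head u)))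

module _ {X : Set} (enc : X → Tree) (φ : Tree → Tree) where

  any-from : ∀ xs a → anyᵗ φ (encodeList (List.map enc xs)) a ≢ nil ⇔
             (a ≢ nil ⊎ ∃[ x ] (x ∈ xs × φ (enc x) ≢ nil))
  any-from []       a = mk⇔ inj₁ [ id , (λ ()) ]′
  any-from (x ∷ xs) a = any-from xs (cond a a (φ (enc x))) ⟨⇔⟩ mk⇔
    [ [ inj₁ , (λ φx → inj₂ (x , here refl , φx)) ]′ ∘ to (or-correct a _)
    , (λ (y , y∈ , φy) → inj₂ (y , there y∈ , φy)) ]′
    λ { (inj₁ a≢nil)                → inj₁ (from (or-correct a _) (inj₁ a≢nil))
      ; (inj₂ (_ , here refl , φx)) → inj₁ (from (or-correct a _) (inj₂ φx))
      ; (inj₂ (y , there y∈ , φy))  → inj₂ (y , y∈ , φy) }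

  any-correct : ∀ xs → anyᵗ φ (encodeList (List.map enc xs)) nil ≢ nil ⇔ (∃[ x ] (x ∈ xs × φ (enc x) ≢ nil))
  any-correct xs = any-from xs nil ⟨⇔⟩ mk⇔ [ contradiction refl , id ]′ inj₂

-- Reduces the agreement of a program loop with a loop of the construction to a single round. The
-- bound `i < k` is passed on because `st` preserves a number only if it names a state.
encode-forDown : ∀ {X : Set} (enc : X → Tree) {f : ℕ → List X → List X} {g : Tree → Tree → Tree} k →
  (∀ {i} → i < k → ∀ xs →
    g (encodeℕ (suc i)) (encodeList (List.map enc xs)) ≡ encodeList (List.map enc (f i xs))) →
  ∀ xs → foldᵗ g (encodeℕ k) (encodeList (List.map enc xs)) ≡ encodeList (List.map enc (forDown f k xs))
encode-forDown enc         zero    g≡f xs = refl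
encode-forDown enc {f} {g} (suc k) g≡f xs =
  trans (cong (foldᵗ g (encodeℕ k)) (g≡f (n<1+n k) xs)) (encode-forDown enc k (g≡f ∘ m<n⇒m<1+n) (f k xs))

forDown-∷ : ∀ {X : Set} (f : ℕ → X) k xs →
            forDown {List X} (λ i → f i ∷_) (suc k) xs ≡ f 0 ∷ forDown (λ i → f (suc i) ∷_) k xs
forDown-∷ f zero    xs = refl
forDown-∷ f (suc k) xs = forDown-∷ f k (f (suc k) ∷ xs)

forDown-tabulate : ∀ {X : Set} (f : ℕ → X) k → forDown {List X} (λ i → f i ∷_) k [] ≡ tabulate {n = k} (f ∘ toℕ)
forDown-tabulate f zero    = refl
forDown-tabulate f (suc k) = trans (forDown-∷ f k []) (cong (f 0 ∷_) (forDown-tabulate (f ∘ suc) k))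

-- Correctness of the algorithm.

module Preprocessed (A : UnaryNFA) where
  open UnaryNFA A
  open Paths A

  m : ℕ
  m = size + size * size

  global : Tree
  global = cons (encodeℕ size)
             (cons (encodeℕ (size * size))
               (cons (encodeℕ (suc m))
                 (cons (encodeℕ (offset (suc m) size))
                   (tail (encode A)))))

  spine-states : spine (head (encode A)) ≡ size
  spine-states = trans (spine-encodeList (List.map encodeState (allFin size)))
                   (trans (length-map encodeState (allFin size)) (length-tabulate id))

  preprocess-correct : eval preprocess (encode A ∷ []) [] ≡ global
  preprocess-correct = cong₂ cons count≡ (cong₂ cons square≡ (cong₂ cons stem≡ (cong₂ cons total≡ refl)))
    where
    states = head (encode A)
    count≡ : addᵗ states nil ≡ encodeℕ size
    count≡ = trans (add-correct states 0) (cong encodeℕ (trans (+-identityʳ _) spine-states))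
    square≡ : foldᵗ (λ _ → addᵗ states) states nil ≡ encodeℕ (size * size)
    square≡ = trans (product-correct states states 0)
                (cong encodeℕ (trans (+-identityʳ _) (cong₂ _*_ spine-states spine-states)))
    stem≡ : cons nil (addᵗ states (foldᵗ (λ _ → addᵗ states) states nil)) ≡ encodeℕ (suc m)
    stem≡ = cong (cons nil) (trans (cong (addᵗ states) square≡)
              (trans (add-correct states (size * size)) (cong (λ n → encodeℕ (n + size * size)) spine-states)))
    total≡ : foldᵗ addᵗ states (cons nil (addᵗ states (foldᵗ (λ _ → addᵗ states) states nil))) ≡
             encodeℕ (offset (suc m) size)
    total≡ = trans (cong (foldᵗ addᵗ states) stem≡)
               (trans (offset-correct states (suc m)) (cong (λ n → encodeℕ (offset (suc m) n)) spine-states))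

  Represents : Tree → (State → Set) → Set
  Represents t P = ∀ s → nthᵗ (encodeState s) t ≢ nil ⇔ P s

  represents-⇔ : ∀ {t P Q} → (∀ s → P s ⇔ Q s) → Represents t P → Represents t Q
  represents-⇔ P⇔Q R s = R s ⟨⇔⟩ P⇔Q s

  comprehension-represents : ∀ (φ : Tree → Tree) {P : State → Set} → (∀ s → φ (encodeℕ (suc (toℕ s))) ≢ nil ⇔ P s) →
                             Represents (foldᵗ (λ u → cons (φ u)) (encodeℕ size) nil) P
  comprehension-represents φ φ⇔P s = ≡⇒≢nil⇔ (nth-comprehension φ size nil (toℕ<n s)) ⟨⇔⟩ φ⇔P s

  Successors : (State → Set) → State → Set
  Successors P s′ = ∃[ s ] (P s × s′ ∈succ s)

  After : ℕ → (State → Set) → State → Set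
  After x P s′ = ∃[ s ] (P s × Path x s s′)

  advance-represents : ∀ {t P} → Represents t P → Represents (eval advance (global ∷ []) (t ∷ [])) (Successors P)
  advance-represents {t} {P} R = comprehension-represents
    (λ u → anyᵗ (edgeTo u) (encodeList (List.map encodeTransition transitions)) nil)
    λ s′ → any-correct encodeTransition (edgeTo (encodeℕ (suc (toℕ s′)))) transitions ⟨⇔⟩ mk⇔
      (λ { ((s , s″) , e∈ , e≢nil) →
           let s″≡s′ , s∈ = to (edge-correct s s″ s′) e≢nil
           in s , to (R s) s∈ ,
              subst (_∈succ s) (toℕ-injective (to (equal-correct (toℕ s″) (toℕ s′)) s″≡s′)) e∈ })
      (λ { (s , Ps , e∈) → (s , s′) , e∈ ,
           from (edge-correct s s′ s′) (from (equal-correct (toℕ s′) (toℕ s′)) refl , from (R s) Ps) })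
    where
    edgeTo : Tree → Tree → Tree
    edgeTo u e = cond (equalᵗ (tail e) (tail u)) (nthᵗ (head e) t) nil
    edge-correct : ∀ s s″ s′ → edgeTo (encodeℕ (suc (toℕ s′))) (encodeTransition (s , s″)) ≢ nil ⇔
                   (equalᵗ (encodeState s″) (encodeState s′) ≢ nil × nthᵗ (encodeState s) t ≢ nil)
    edge-correct s s″ s′ = and-correct (equalᵗ (encodeState s″) (encodeState s′)) (nthᵗ (encodeState s) t)

  iterate-represents : ∀ x {t P} → Represents t P →
                       Represents (eval iterate (encodeℕ x ∷ global ∷ []) (t ∷ [])) (After x P)
  iterate-represents x {t} {P} R = go x R
    where
    go : ∀ x {t P} → Represents t P →
         Represents (foldᵗ (λ _ a → eval advance (global ∷ []) (a ∷ [])) (encodeℕ x) t) (After x P)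
    go zero    R = represents-⇔ (λ s → mk⇔ (λ Ps → s , Ps , stay) λ { (_ , Ps , stay) → Ps }) R
    go (suc x) R = represents-⇔ (λ s → mk⇔
      (λ { (s′ , (s″ , Ps″ , e) , π) → s″ , Ps″ , step e π })
      (λ { (s″ , Ps″ , step e π) → _ , (s″ , Ps″ , e) , π }))
      (go x (advance-represents R))

  singleton-represents : ∀ q → Represents (eval singleton (encodeState q ∷ global ∷ []) (nil ∷ [])) (q ≡_)
  singleton-represents q = comprehension-represents (λ u → equalᵗ (encodeState q) (tail u))
    λ s → equal-correct (toℕ q) (toℕ s) ⟨⇔⟩ mk⇔ toℕ-injective (cong toℕ)

  restrictToCycle-represents : ∀ j {t P} → Represents t P →
    Represents (eval restrictToCycle (encodeℕ j ∷ global ∷ []) (t ∷ [])) (λ s → P s × Path j s s)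
  restrictToCycle-represents j {t} R = comprehension-represents
    (λ u → cond (nthᵗ (tail u) t)
             (nthᵗ (tail u) (eval iterate (encodeℕ j ∷ global ∷ [])
                              (eval singleton (tail u ∷ global ∷ []) (nil ∷ []) ∷ []))) nil)
    λ s → and-correct (nthᵗ (encodeState s) t) _ ⟨⇔⟩ mk⇔
      (λ (s∈ , s∈′) → to (R s) s∈ , closed (to (iterate-represents j (singleton-represents s) s) s∈′))
      (λ (Ps , π) → from (R s) Ps , from (iterate-represents j (singleton-represents s) s) (s , refl , π))
    where
    closed : ∀ {s} → After j (s ≡_) s → Path j s s
    closed (_ , refl , π) = π

  meetsFinal-correct : ∀ {t P} → Represents t P →
    eval meetsFinal (global ∷ []) (t ∷ []) ≢ nil ⇔ (∃[ f ] (f ∈ final × P f))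
  meetsFinal-correct {t} R = any-correct encodeState (λ f → nthᵗ f t) final ⟨⇔⟩
    mk⇔ (λ (f , f∈ , f∈t) → f , f∈ , to (R f) f∈t) (λ (f , f∈ , Pf) → f , f∈ , from (R f) Pf)

  -- Finality in the construction is given by the program's own tests, so the output matches it by
  -- computation; walks enter only through `short-correct` and `periodic-correct`.
  short : ℕ → Tree
  short x = eval shortTest (encodeℕ x ∷ global ∷ []) (nil ∷ [])

  periodic : ℕ → ℕ → Tree
  periodic i h = eval periodicTest (encodeℕ (suc h) ∷ encodeℕ (suc i) ∷ global ∷ []) (nil ∷ [])

  short-correct : ∀ x → short x ≢ nil ⇔ Accepts x
  short-correct x = meetsFinal-correct (iterate-represents x (singleton-represents initial)) ⟨⇔⟩
    mk⇔ (λ { (f , f∈ , _ , refl , π) → f , f∈ , π }) (λ (f , f∈ , π) → f , f∈ , initial , refl , π)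

  periodic-correct : ∀ i h → periodic i h ≢ nil ⇔ AcceptsThroughCycle size (suc i) (size * size + suc h)
  periodic-correct i h = meetsFinal-correct
    (iterate-represents (suc h) (iterate-represents (size * size)
      (restrictToCycle-represents (suc i) (iterate-represents size (singleton-represents initial))))) ⟨⇔⟩
    mk⇔ (λ { (f , f∈ , _ , (q , ((_ , refl , α) , γ) , β) , β′) → q , f , f∈ , α , γ , β ++ β′ })
        -- The walk `β` is cut after `n²` steps, where the program passes from one iteration to the
        -- next.
        (λ (q , f , f∈ , α , γ , β) →
          f , f∈ , at β (size * size) ,
          (q , ((initial , refl , α) , γ) , prefix β (m≤m+n (size * size) (suc h))) ,
          relength (m+n∸m≡n (size * size) (suc h)) (suffix β (m≤m+n (size * size) (suc h))))

  open Construction size m short periodic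
    using (off; st; node; automaton; Name; stem; cycle; toℕ-st; chainStep; alongStep; cycleSteps; stemFinal; nodeFinal)

  chrobakForm : UnaryNFA
  chrobakForm = automaton

  encode-st : ∀ {x} → Name x → encodeState (st x) ≡ encodeℕ x
  encode-st x = cong encodeℕ (toℕ-st x)

  offᵗ : ℕ → Tree
  offᵗ i = foldᵗ addᵗ (encodeℕ i) (encodeℕ (suc m))

  encode-off : ∀ i → offᵗ i ≡ encodeℕ (off i)
  encode-off i = trans (offset-correct (encodeℕ i) (suc m)) (cong (encodeℕ ∘ off) (spine-encodeℕ i))

  encode-node : ∀ {i h} → i < size → h ≤ i → addᵗ (encodeℕ h) (offᵗ i) ≡ encodeState (st (node i h))
  encode-node {i} {h} i<n h≤i = begin
    addᵗ (encodeℕ h) (offᵗ i)               ≡⟨ cong (addᵗ (encodeℕ h)) (encode-off i) ⟩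
    addᵗ (encodeℕ h) (encodeℕ (off i))      ≡⟨ add-correct (encodeℕ h) (off i) ⟩
    encodeℕ (spine (encodeℕ h) + off i)     ≡⟨ cong (λ k → encodeℕ (k + off i)) (spine-encodeℕ h) ⟩
    encodeℕ (node i h)                      ≡⟨ encode-st (cycle i<n h≤i) ⟨
    encodeState (st (node i h))             ∎
    where open ≡-Reasoning

  encode-stem : ∀ {x} → x ≤ m → encodeℕ x ≡ encodeState (st x)
  encode-stem x≤m = sym (encode-st (stem x≤m))

  states-correct : eval statesTerm (global ∷ []) [] ≡ encodeList (List.map encodeState (allFin (off size)))
  states-correct = begin
    foldᵗ (λ u → cons (tail u)) (encodeℕ (off size)) nil
      ≡⟨ encode-forDown id (off size) (λ _ _ → refl) [] ⟩
    encodeList (List.map id (forDown (λ i → encodeℕ i ∷_) (off size) []))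
      ≡⟨ cong (λ ts → encodeList (List.map id ts)) (forDown-tabulate encodeℕ (off size)) ⟩
    encodeList (List.map id (tabulate encodeState))
      ≡⟨ cong encodeList (map-tabulate encodeState id) ⟩
    encodeList (tabulate encodeState)
      ≡⟨ cong encodeList (map-tabulate id encodeState) ⟨
    encodeList (List.map encodeState (allFin (off size))) ∎
    where open ≡-Reasoning

  transitions-correct : eval transitionsTerm (global ∷ []) [] ≡
    encodeList (List.map encodeTransition (UnaryNFA.transitions chrobakForm))
  transitions-correct = trans
    (cong (foldᵗ (λ u → cons (cons (tail u) u)) (encodeℕ m)) (encode-forDown encodeTransition size cycle≡ []))
    (encode-forDown encodeTransition m chain≡ (forDown cycleSteps size []))
    where
    chain≡ : ∀ {x} → x < m → ∀ ts → _ ≡ encodeList (List.map encodeTransition (chainStep x ts))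
    chain≡ x<m ts = cong₂ cons (cong₂ cons (encode-stem (<⇒≤ x<m)) (encode-stem x<m)) refl
    along≡ : ∀ {i} → i < size → ∀ {h} → h < i → ∀ ts →
             _ ≡ encodeList (List.map encodeTransition (alongStep i h ts))
    along≡ i<n h<i ts = cong₂ cons (cong₂ cons (encode-node i<n (<⇒≤ h<i)) (encode-node i<n h<i)) refl
    cycle≡ : ∀ {i} → i < size → ∀ ts → _ ≡ encodeList (List.map encodeTransition (cycleSteps i ts))
    cycle≡ {i} i<n ts =
      cong₂ cons (cong₂ cons (encode-stem ≤-refl) (encode-node i<n z≤n))
        (cong₂ cons (cong₂ cons (encode-node i<n ≤-refl) (encode-node i<n z≤n))
          (encode-forDown encodeTransition i (along≡ i<n) ts))

  final-correct : eval finalTerm (global ∷ []) [] ≡ encodeList (List.map encodeState (UnaryNFA.final chrobakForm))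
  final-correct = trans
    (cong (foldᵗ _ (encodeℕ (suc m)))
      (encode-forDown (encodeState {off size}) size (λ i<n → encode-forDown (encodeState {off size}) _ (node≡ i<n)) []))
    (encode-forDown (encodeState {off size}) (suc m) stem≡ (forDown (λ i → forDown (nodeFinal i) (suc i)) size []))
    where
    encode-cond : ∀ t {u x} xs → u ≡ encodeState x →
      cond t (cons u (encodeList (List.map encodeState xs))) (encodeList (List.map encodeState xs)) ≡
      encodeList (List.map (encodeState {off size}) (cond t (x ∷ xs) xs))
    encode-cond nil        xs refl = refl
    encode-cond (cons _ _) xs refl = refl
    stem≡ : ∀ {x} → x < suc m → ∀ xs → _ ≡ encodeList (List.map encodeState (stemFinal x xs))
    stem≡ {x} (s≤s x≤m) xs = encode-cond (short x) xs (encode-stem x≤m)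
    node≡ : ∀ {i} → i < size → ∀ {h} → h < suc i → ∀ xs →
            _ ≡ encodeList (List.map encodeState (nodeFinal i h xs))
    node≡ {i} i<n {h} (s≤s h≤i) xs = encode-cond (periodic i h) xs (encode-node i<n h≤i)

  output-correct : eval output (global ∷ []) [] ≡ encode chrobakForm
  output-correct = cong₂ cons states-correct
    (cong₂ cons transitions-correct (cong₂ cons (encode-stem z≤n) final-correct))

-- Sizes and running time.

spine≤size : ∀ t → spine t ≤ ∣ t ∣ᵗ
spine≤size nil        = z≤n
spine≤size (cons t u) = s≤s (≤-trans (spine≤size u) (m≤n+m ∣ u ∣ᵗ ∣ t ∣ᵗ))

encodeℕ-size : ∀ k → ∣ encodeℕ k ∣ᵗ ≡ suc (k + k)
encodeℕ-size zero    = refl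
encodeℕ-size (suc k) = cong (suc ∘ suc) (trans (encodeℕ-size k) (sym (+-suc k k)))

numeralSize : ℕ → ℕ
numeralSize k = suc (k + k)

-- Bounds `global` without its root, with `n` and the size of the remaining input both overestimated
-- by the input size `s`. The local `m` stands for `suc m` of the construction.
globalSize : ℕ → ℕ
globalSize s = numeralSize s + suc (numeralSize (s * s) + suc (numeralSize m +
                 suc (numeralSize (m + s * s) + s)))
  where
  m = suc (s + s * s)

globalSize-polynomial : Polynomial globalSize
globalSize-polynomial = numeral s ⊕ (one ⊕ (numeral (s ⊗ s) ⊕ (one ⊕ (numeral m ⊕
                          (one ⊕ (numeral (m ⊕ (s ⊗ s)) ⊕ s))))))
  where
  infixr 5 _⊕_
  _⊕_ = polynomial-+
  _⊗_ = polynomial-*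
  s   = polynomial-id
  one = polynomial-const 1
  m   = one ⊕ (s ⊕ (s ⊗ s))
  numeral : ∀ {g} → Polynomial g → Polynomial (λ s → numeralSize (g s))
  numeral p = one ⊕ (p ⊕ p)

module _ (A : UnaryNFA) where
  open UnaryNFA A using (size)
  open Preprocessed A

  size≤encode : size ≤ ∣ encode A ∣ᵗ
  size≤encode = begin
    size                             ≡⟨ spine-states ⟨
    spine (head (encode A))          ≤⟨ spine≤size (head (encode A)) ⟩
    ∣ head (encode A) ∣ᵗ             ≤⟨ head-size (encode A) ⟩
    ∣ encode A ∣ᵗ                    ∎
    where open ≤-Reasoning

  global-size : ∣ global ∣ᵗ ≤ suc (globalSize ∣ encode A ∣ᵗ)
  global-size = s≤s
    (+-mono-≤ (numeral≤ n≤s) (s≤s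
      (+-mono-≤ (numeral≤ n²≤s²) (s≤s
        (+-mono-≤ (numeral≤ m≤) (s≤s
          (+-mono-≤ (numeral≤ (≤-trans (offset-≤ (suc m) size) (+-mono-≤ m≤ n²≤s²)))
            (tail-size (encode A)))))))))
    where
    n≤s = size≤encode
    n²≤s² = *-mono-≤ n≤s n≤s
    m≤ = s≤s (+-mono-≤ n≤s n²≤s²)
    numeral≤ : ∀ {j k} → j ≤ k → ∣ encodeℕ j ∣ᵗ ≤ numeralSize k
    numeral≤ {j} j≤k = ≤-trans (≤-reflexive (encodeℕ-size j)) (s≤s (+-mono-≤ j≤k j≤k))

  chrobakForm-equivalent : Equivalent A chrobakForm
  chrobakForm-equivalent = equivalent A short periodic short-correct periodic-correct

  chrobakForm-isChrobak : ChrobakNormalForm chrobakForm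
  chrobakForm-isChrobak = Construction.chrobak size m short periodic

  -- The stem has `1 + n + n²` states and the cycles have at most `n²`; each of these four terms is
  -- at most `n²`.
  chrobakForm-size : UnaryNFA.size chrobakForm ≤ 4 * size ^ 2
  chrobakForm-size = begin
    offset (suc m) size                                    ≤⟨ offset-≤ (suc m) size ⟩
    1 + (size + size * size) + size * size
      ≤⟨ +-monoˡ-≤ (size * size) (+-mono-≤ 1≤n² (+-monoˡ-≤ (size * size) n≤n²)) ⟩
    size * size + (size * size + size * size) + size * size
      ≡⟨ regroup size ⟩
    4 * size ^ 2                                           ∎
    where
    open ≤-Reasoning
    -- The initial state witnesses that `n` is positive, so that `n²` absorbs the term 1.
    1≤n : 1 ≤ size
    1≤n = ≤-trans (s≤s z≤n) (toℕ<n (UnaryNFA.initial A))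
    1≤n² : 1 ≤ size * size
    1≤n² = *-mono-≤ 1≤n 1≤n
    n≤n² : size ≤ size * size
    n≤n² = ≤-trans (≤-reflexive (sym (*-identityˡ size))) (*-monoˡ-≤ size 1≤n)
    regroup : ∀ n → n * n + (n * n + n * n) + n * n ≡ 4 * (n * (n * 1))
    regroup = solve-∀

-- Running `output` on the result of `preprocess` is the one place where a computed tree becomes
-- read-only. The size of that tree is polynomial, so a single composition of polynomials bounds the
-- second stage.
program : Cmd
program = compile (0 ∷ []) [] 1 preprocess ⨾ compile (1 ∷ []) [] 2 output ⨾ 0 := var 2

program-time : ℕ → ℕ
program-time s = timeBound preprocess s + (timeBound output (suc (globalSize s)) + 2)

program-time-polynomial : Polynomial program-time
program-time-polynomial = polynomial-+ (timeBound-polynomial preprocess)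
  (polynomial-+ (polynomial-∘ (timeBound-polynomial output) globalSize-polynomial) (polynomial-const 2))

program-correct : ∀ A → program on encode A outputs encode (Preprocessed.chrobakForm A)
                        within program-time ∣ encode A ∣ᵗ
program-correct A =
  _ , _ , ⇓seq (run p) (⇓seq (run q) ⇓assign) ,
  trans (result q) (trans (cong (λ g → eval output (g ∷ []) []) preprocess-correct) output-correct) ,
  +-mono-≤ (within p) (+-monoˡ-≤ 2 (within q))
  where
  open Preprocessed A using (preprocess-correct; output-correct)
  p = compile-correct preprocess {d = 1} (≤-refl ∷ []) ((s≤s z≤n , refl) ∷ []) []
  q = compile-correct output {d = 2}
        (subst (λ g → ∣ g ∣ᵗ ≤ suc (globalSize ∣ encode A ∣ᵗ)) (sym preprocess-correct) (global-size A) ∷ [])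
        ((s≤s (s≤s z≤n) , result p) ∷ []) []

chrobakForm-polynomialTime : PolynomialTime Preprocessed.chrobakForm
chrobakForm-polynomialTime =
  let c , d , time≤ = program-time-polynomial
  in program , c , d , λ A →
    let σ , t , run , σ0≡ , t≤ = program-correct A
    in σ , t , run , σ0≡ , ≤-trans t≤ (≤-trans (time≤ ∣ encode A ∣ᵗ) (m≤m+n _ c))

theorem2 : ∃[ f ] (PolynomialTime f
    × (∀ A → Equivalent A (f A) × ChrobakNormalForm (f A))
    × (∃[ C ] ∀ A → UnaryNFA.size (f A) ≤ C * UnaryNFA.size A ^ 2))
theorem2 = Preprocessed.chrobakForm , chrobakForm-polynomialTime
  , (λ A → chrobakForm-equivalent A , chrobakForm-isChrobak A)
  , 4 , chrobakForm-size
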